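{- Let $n\ge 3$ and let $S_n^2 = K_n\vee\overline{K_2}$ be the complete split graph. Then the all-negative signature maximises the frustration index of $S_n^2$ uniquely, and \[ l_{\max}(S_n^2) = l(-S_n^2) = \left\lfloor \frac{(n-1)^2}{4} + n - 1\right\rfloor . \]
   Context: All graphs are finite, simple and undirected. A signed graph $\Sigma=(G,\sigma)$ is a graph $G$ with a signature $\sigma:E(G)\to\{+1,-1\}$. The sign of a cycle is the product of the signs of its edges; $\Sigma$ is balanced if all its cycles are positive. The frustration index $l(\Sigma)$ is the minimum number of edges whose deletion makes $\Sigma$ balanced. $-G$ is $G$ with all edges signed $-1$. $l_{\max}(G)=\max_\sigma l(G,\sigma)$. Switching $\Sigma$ at a vertex subset $X$ negates the signs of all edges with exactly one endpoint in $X$; two signatures are switching equivalent if one is obtained from the other by switching. The all-negative signature maximises the frustration index of $G$ uniquely if $l(-G)=l_{\max}(G)$ and every $\sigma$ with $l(G,\sigma)=l_{\max}(G)$ is switching equivalent to the all-negative signature. $\overline{K_m}$ is the edgeless graph on $m$ vertices and $\vee$ denotes the join. -}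

module Defs where

open import Data.Bool.Base using (Bool; true; false; T; not; _∧_; _xor_; if_then_else_)
open import Data.Bool.Properties as Bool using (T?; T-irrelevant; T-∧)
open import Data.Empty using (⊥-elim)
open import Data.Fin.Base using (Fin; zero; suc; toℕ; fromℕ<; splitAt)
open import Data.Fin.Properties as Fin using (_≟_; _<?_; any?; all?; toℕ-fromℕ<; injective⇒≤)
open import Data.Fin.Subset using (Subset)
open import Data.List.Base as List using (List; []; _∷_)
open import Data.List.Relation.Unary.All as All using ()
open import Data.List.Relation.Unary.AllPairs using ([]; _∷_; allPairs?)
open import Data.List.Relation.Unary.Unique.Propositional using (Unique)
open import Data.List.Membership.Propositional.Properties using (∈-lookup)
open import Data.Nat.Base as ℕ using (ℕ; zero; suc; _≤_; z≤n; s≤s)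
open import Data.Nat.Properties as ℕ using (+-0-commutativeMonoid)
open import Data.Product.Base using (Σ; ∃; ∃-syntax; _×_; _,_; proj₁; proj₂)
open import Data.Sign.Base using (Sign; +; -; opposite) renaming (_*_ to _·_)
open import Data.Sign.Properties as Sign using ()
open import Data.Sum.Base using (_⊎_; inj₁; inj₂)
open import Data.Vec.Base as Vec using ()
open import Data.Vec.Functional as Vector using (Vector)
open import Function.Base using (_∘_)
open import Function.Bundles using (Equivalence)
open import Relation.Binary.PropositionalEquality
  using (_≡_; _≢_; refl; sym; trans; cong; cong₂; subst)
open import Relation.Nullary
  using (¬_; Dec; yes; no; does; ¬?; _×-dec_; _→-dec_; contradiction)
open import Relation.Nullary.Decidable using (map′; decidable-stable)
open import Relation.Unary using (Decidable)

open import Algebra.Properties.CommutativeMonoid.Sum +-0-commutativeMonoid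
  using (sum-syntax; sum-cong-≗)

record Graph (n : ℕ) : Set where
  field
    adj        : Fin n → Fin n → Bool
    adj-sym    : ∀ u v → adj u v ≡ adj v u
    adj-irrefl : ∀ v → adj v v ≡ false

open Graph public

infix 4 _[_~_]
_[_~_] : ∀ {n} → Graph n → Fin n → Fin n → Set
G [ u ~ v ] = T (adj G u v)

-- Edge sets on a fixed vertex set are themselves graphs on that vertex
-- set, so `size` is also the cardinality of an edge set.
size : ∀ {n} → Graph n → ℕ
size {n} G = ∑[ u < n ] ∑[ v < n ] (if does (u <? v) ∧ adj G u v then 1 else 0)

infix 4 _⊆_
_⊆_ : ∀ {n} → Graph n → Graph n → Set
D ⊆ G = ∀ {u v} → D [ u ~ v ] → G [ u ~ v ]

infixl 6 _∖_
_∖_ : ∀ {n} → Graph n → Graph n → Graph n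
G ∖ D = record
  { adj        = λ u v → adj G u v ∧ not (adj D u v)
  ; adj-sym    = λ u v → cong₂ (λ a b → a ∧ not b) (adj-sym G u v) (adj-sym D u v)
  ; adj-irrefl = λ v → cong (_∧ not (adj D v v)) (adj-irrefl G v)
  }

∖-⊆ : ∀ {n} (G D : Graph n) → G ∖ D ⊆ G
∖-⊆ G D e = proj₁ (Equivalence.to T-∧ e)

K : ∀ n → Graph n
K n = record
  { adj        = λ u v → not (does (u ≟ v))
  ; adj-sym    = symm
  ; adj-irrefl = irr
  }
  where
  symm : ∀ (u v : Fin n) → not (does (u ≟ v)) ≡ not (does (v ≟ u))
  symm u v with u ≟ v | v ≟ u
  ... | yes _  | yes _  = refl
  ... | no  _  | no  _  = refl
  ... | yes eq | no ¬eq = contradiction (sym eq) ¬eq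
  ... | no ¬eq | yes eq = contradiction (sym eq) ¬eq

  irr : ∀ (v : Fin n) → not (does (v ≟ v)) ≡ false
  irr v with v ≟ v
  ... | yes _  = refl
  ... | no ¬eq = contradiction refl ¬eq

K̅ : ∀ n → Graph n
K̅ n = record
  { adj        = λ _ _ → false
  ; adj-sym    = λ _ _ → refl
  ; adj-irrefl = λ _ → refl
  }

infixr 5 _∨_
_∨_ : ∀ {m n} → Graph m → Graph n → Graph (m ℕ.+ n)
_∨_ {m} {n} G H = record
  { adj        = λ u v → join (splitAt m u) (splitAt m v)
  ; adj-sym    = λ u v → symm (splitAt m u) (splitAt m v)
  ; adj-irrefl = λ v → irr (splitAt m v)
  }
  where
  join : Fin m ⊎ Fin n → Fin m ⊎ Fin n → Bool
  join (inj₁ u) (inj₁ v) = adj G u v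
  join (inj₁ _) (inj₂ _) = true
  join (inj₂ _) (inj₁ _) = true
  join (inj₂ u) (inj₂ v) = adj H u v

  symm : ∀ x y → join x y ≡ join y x
  symm (inj₁ u) (inj₁ v) = adj-sym G u v
  symm (inj₁ _) (inj₂ _) = refl
  symm (inj₂ _) (inj₁ _) = refl
  symm (inj₂ u) (inj₂ v) = adj-sym H u v

  irr : ∀ x → join x x ≡ false
  irr (inj₁ v) = adj-irrefl G v
  irr (inj₂ v) = adj-irrefl H v

completeSplit : (n k : ℕ) → Graph (n ℕ.+ k)
completeSplit n k = K n ∨ K̅ k

module _ {n} (G : Graph n) where

  infixr 5 _∷_
  data Walk : Fin n → Fin n → Set where
    []  : ∀ {v} → Walk v v
    _∷_ : ∀ {u v w} → G [ u ~ v ] → Walk v w → Walk u w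

module _ {n} {G : Graph n} where

  length : ∀ {u v} → Walk G u v → ℕ
  length []      = 0
  length (_ ∷ w) = suc (length w)

  vertices : ∀ {u v} → Walk G u v → List (Fin n)
  vertices {u} []      = u ∷ []
  vertices {u} (_ ∷ w) = u ∷ vertices w

-- A cycle is a path with at least three vertices together with an edge
-- joining its two ends.
record Cycle {n} (G : Graph n) : Set where
  field
    {first last} : Fin n
    path         : Walk G first last
    isPath       : Unique (vertices path)
    2≤length     : 2 ≤ length path
    closing      : G [ last ~ first ]

open Cycle public

-- `sign-sym` also makes the sign independent of the proof of adjacency.
record Signature {n} (G : Graph n) : Set where
  field
    sign     : ∀ {u v} → G [ u ~ v ] → Sign
    sign-sym : ∀ {u v} (e : G [ u ~ v ]) (e′ : G [ v ~ u ]) → sign e ≡ sign e′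

open Signature public

infix 4 _≈_
_≈_ : ∀ {n} {G : Graph n} → Signature G → Signature G → Set
_≈_ {G = G} σ τ = ∀ {u v} (e : G [ u ~ v ]) → sign σ e ≡ sign τ e

allNegative : ∀ {n} {G : Graph n} → Signature G
allNegative = record { sign = λ _ → - ; sign-sym = λ _ _ → refl }

restrict : ∀ {n} {G H : Graph n} → H ⊆ G → Signature G → Signature H
restrict H⊆G σ = record
  { sign     = λ e → sign σ (H⊆G e)
  ; sign-sym = λ e e′ → sign-sym σ (H⊆G e) (H⊆G e′)
  }

walkSign : ∀ {n} {G : Graph n} → Signature G → ∀ {u v} → Walk G u v → Sign
walkSign σ []      = +
walkSign σ (e ∷ w) = sign σ e · walkSign σ w

cycleSign : ∀ {n} {G : Graph n} → Signature G → Cycle G → Sign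
cycleSign σ c = sign σ (closing c) · walkSign σ (path c)

Balanced : ∀ {n} (G : Graph n) → Signature G → Set
Balanced G σ = ∀ (c : Cycle G) → cycleSign σ c ≡ +

switch : ∀ {n} {G : Graph n} → Subset n → Signature G → Signature G
switch {G = G} X σ = record
  { sign     = λ {u} {v} e → flip u v (sign σ e)
  ; sign-sym = λ {u} {v} e e′ →
      cong₂ (λ b s → if b then opposite s else s)
            (Bool.xor-comm (Vec.lookup X u) (Vec.lookup X v)) (sign-sym σ e e′)
  }
  where
  flip : ∀ u v → Sign → Sign
  flip u v s = if Vec.lookup X u xor Vec.lookup X v then opposite s else s

SwitchingEquivalent : ∀ {n} {G : Graph n} → Signature G → Signature G → Set
SwitchingEquivalent σ τ = ∃[ X ] switch X σ ≈ τ

IsMinimum : (ℕ → Set) → ℕ → Set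
IsMinimum P k = P k × (∀ j → P j → k ≤ j)

IsMaximum : (ℕ → Set) → ℕ → Set
IsMaximum P k = P k × (∀ j → P j → j ≤ k)

minimum : ∀ {P : ℕ → Set} → Decidable P → ∃ P → ∃ (IsMinimum P)
minimum {P} P? (m , pm) = fromBelow (below (suc m))
  where
  below : ∀ b → ∃ (IsMinimum P) ⊎ (∀ j → P j → b ≤ j)
  below zero    = inj₂ λ _ _ → z≤n
  below (suc b) with below b
  ... | inj₁ found = inj₁ found
  ... | inj₂ b≤ with P? b
  ...   | yes pb = inj₁ (b , pb , b≤)
  ...   | no ¬pb = inj₂ λ j pj → ℕ.≤∧≢⇒< (b≤ j pj) λ { refl → ¬pb pj }

  fromBelow : ∃ (IsMinimum P) ⊎ (∀ j → P j → suc m ≤ j) → ∃ (IsMinimum P)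
  fromBelow (inj₁ found) = found
  fromBelow (inj₂ m<)    = contradiction (m< m pm) (ℕ.<-irrefl refl)

maximum : ∀ {P : ℕ → Set} → Decidable P → ∃ P →
          ∀ b → (∀ j → P j → j ≤ b) → ∃ (IsMaximum P)
maximum P? (m , pm) b ≤b with P? b
... | yes pb = b , pb , ≤b
maximum P? (m , pm) zero ≤b | no ¬p0 with ≤b m pm
... | z≤n = contradiction pm ¬p0
maximum P? ∃P (suc b) ≤b | no ¬pb =
  maximum P? ∃P b λ j pj → ℕ.≤-pred (ℕ.≤∧≢⇒< (≤b j pj) λ { refl → ¬pb pj })

Σ-dec : ∀ {A : Set} {P : A → Set} → Dec A → Decidable P →
        (∀ {x y} → P x → P y) → Dec (Σ A P)
Σ-dec (no ¬a) P? resp = no (¬a ∘ proj₁)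
Σ-dec (yes a) P? resp = map′ (a ,_) (resp ∘ proj₂) (P? a)

module _ {n} (G : Graph n) where

  walk? : ∀ k u v {P : Walk G u v → Set} → Decidable P →
          Dec (∃[ w ] length w ≡ k × P w)
  walk? zero u v P? with u ≟ v
  ... | yes refl = map′ (λ p → [] , refl , p) (λ { ([] , refl , p) → p }) (P? [])
  ... | no u≢v   = no λ { ([] , _) → u≢v refl }
  walk? (suc k) u v {P} P? =
    map′ (λ { (x , e , w , len , p) → e ∷ w , cong suc len , p })
         (λ { (e ∷ w , len , p) → _ , e , w , ℕ.suc-injective len , p })
         (any? λ x → Σ-dec (T? (adj G u x))
                           (λ e → walk? k x v (λ w → P? (e ∷ w)))
                           (λ {e} {e′} → subst (λ e → ∃[ w ] length w ≡ k × P (e ∷ w))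
                                               (T-irrelevant e e′)))

  lookup-injective : ∀ {xs : List (Fin n)} → Unique xs →
                     ∀ {i j} → List.lookup xs i ≡ List.lookup xs j → i ≡ j
  lookup-injective (_ ∷ _) {zero}  {zero}  _  = refl
  lookup-injective (p ∷ _) {zero}  {suc j} eq = contradiction eq (All.lookup p (∈-lookup j))
  lookup-injective (p ∷ _) {suc i} {zero}  eq = contradiction (sym eq) (All.lookup p (∈-lookup i))
  lookup-injective (_ ∷ u) {suc i} {suc j} eq = cong suc (lookup-injective u eq)

  length-vertices : ∀ {u v} (w : Walk G u v) → List.length (vertices w) ≡ suc (length w)
  length-vertices []      = refl
  length-vertices (_ ∷ w) = cong suc (length-vertices w)

  path-length : ∀ {u v} (w : Walk G u v) → Unique (vertices w) → length w ℕ.< n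
  path-length w unique =
    subst (_≤ n) (length-vertices w) (injective⇒≤ (lookup-injective unique))

  module _ (σ : Signature G) where

    NegativeCycle : Set
    NegativeCycle = ∃[ c ] cycleSign σ c ≢ +

    negativeCycle? : Dec NegativeCycle
    negativeCycle? =
      map′ (λ { (k , u , v , w , _ , unique , 2≤ , e , neg) →
                record { path = w ; isPath = unique ; 2≤length = 2≤ ; closing = e } , neg })
           (λ { (c , neg) → fromℕ< (path-length (path c) (isPath c)) , first c , last c , path c
                          , sym (toℕ-fromℕ< _) , isPath c , 2≤length c , closing c , neg })
           (any? {n} λ k → any? λ u → any? λ v → walk? (toℕ k) u v λ w →
             allPairs? (λ x y → ¬? (x ≟ y)) (vertices w) ×-dec
             2 ℕ.≤? length w ×-dec
             Σ-dec (T? (adj G v u))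
                   (λ e → ¬? ((sign σ e · walkSign σ w) Sign.≟ +))
                   (λ {e} {e′} → subst (λ e → sign σ e · walkSign σ w ≢ +) (T-irrelevant e e′)))

    balanced? : Dec (Balanced G σ)
    balanced? = map′
      (λ ¬neg c → decidable-stable (cycleSign σ c Sign.≟ +) (λ neg → ¬neg (c , neg)))
      (λ bal (c , neg) → neg (bal c))
      (¬? negativeCycle?)

-- Balance is inherited along inclusions that preserve signs.
module _ {n} {G H : Graph n} {σ : Signature G} {τ : Signature H}
         (H⊆G : H ⊆ G) (τ≈σ : τ ≈ restrict H⊆G σ) where

  mapWalk : ∀ {u v} → Walk H u v → Walk G u v
  mapWalk []      = []
  mapWalk (e ∷ w) = H⊆G e ∷ mapWalk w

  vertices-mapWalk : ∀ {u v} (w : Walk H u v) → vertices (mapWalk w) ≡ vertices w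
  vertices-mapWalk []      = refl
  vertices-mapWalk (e ∷ w) = cong (_ ∷_) (vertices-mapWalk w)

  length-mapWalk : ∀ {u v} (w : Walk H u v) → length (mapWalk w) ≡ length w
  length-mapWalk []      = refl
  length-mapWalk (e ∷ w) = cong suc (length-mapWalk w)

  walkSign-mapWalk : ∀ {u v} (w : Walk H u v) → walkSign τ w ≡ walkSign σ (mapWalk w)
  walkSign-mapWalk []      = refl
  walkSign-mapWalk (e ∷ w) = cong₂ _·_ (τ≈σ e) (walkSign-mapWalk w)

  mapCycle : Cycle H → Cycle G
  mapCycle c = record
    { path     = mapWalk (path c)
    ; isPath   = subst Unique (sym (vertices-mapWalk (path c))) (isPath c)
    ; 2≤length = subst (2 ≤_) (sym (length-mapWalk (path c))) (2≤length c)
    ; closing  = H⊆G (closing c)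
    }

  balanced-⊆ : Balanced G σ → Balanced H τ
  balanced-⊆ bal c =
    trans (cong₂ _·_ (τ≈σ (closing c)) (walkSign-mapWalk (path c))) (bal (mapCycle c))

Searchable : (A : Set) → (A → A → Set) → Set₁
Searchable A _≋_ = ∀ {P : A → Set} → (∀ {x y} → x ≋ y → P x → P y) →
                   Decidable P → Dec (∃ P)

search-Bool : Searchable Bool _≡_
search-Bool resp P? with P? true | P? false
... | yes p | _     = yes (true , p)
... | no _  | yes p = yes (false , p)
... | no ¬p | no ¬q = no λ { (true , p) → ¬p p ; (false , q) → ¬q q }

search-Sign : Searchable Sign _≡_
search-Sign resp P? with P? + | P? -
... | yes p | _     = yes (+ , p)
... | no _  | yes p = yes (- , p)
... | no ¬p | no ¬q = no λ { (+ , p) → ¬p p ; (- , q) → ¬q q }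

search-→ : ∀ {A _≋_} → (∀ {x} → x ≋ x) → Searchable A _≋_ →
           ∀ n → Searchable (Fin n → A) (λ f g → ∀ i → f i ≋ g i)
search-→ ≋-refl search zero resp P? =
  map′ (_ ,_) (λ (_ , p) → resp (λ ()) p) (P? λ ())
search-→ {_≋_ = _≋_} ≋-refl search (suc n) {P} resp P? =
  map′ (λ (x , f , p) → x Vector.∷ f , p)
       (λ (f , p) → f zero , f ∘ suc , resp (λ { zero → ≋-refl ; (suc _) → ≋-refl }) p)
       (search (λ x≋y (f , p) → f , resp (λ { zero → x≋y ; (suc _) → ≋-refl }) p)
               (λ x → search-→ ≋-refl search n
                        (λ f≋g → resp λ { zero → ≋-refl ; (suc i) → f≋g i })
                        (λ f → P? (x Vector.∷ f))))

search-matrix : ∀ {A} → Searchable A _≡_ → ∀ n →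
                Searchable (Fin n → Fin n → A) (λ f g → ∀ i j → f i j ≡ g i j)
search-matrix search n = search-→ (λ _ → refl) (search-→ refl search n) n

module _ {n} (G : Graph n) (σ : Signature G) where

  BalancedByDeleting : Graph n → ℕ → Set
  BalancedByDeleting D k =
    D ⊆ G × size D ≡ k × Balanced (G ∖ D) (restrict (∖-⊆ G D) σ)

  BalancedByDeletingSome : ℕ → Set
  BalancedByDeletingSome k = ∃[ D ] BalancedByDeleting D k

size-cong : ∀ {n} (D D′ : Graph n) → (∀ u v → adj D u v ≡ adj D′ u v) → size D ≡ size D′
size-cong D D′ eq = sum-cong-≗ λ u → sum-cong-≗ λ v →
  cong (λ a → if does (u <? v) ∧ a then 1 else 0) (eq u v)

balancedByDeleting-cong :
  ∀ {n} {G : Graph n} (σ τ : Signature G) → σ ≈ τ →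
  ∀ D D′ → (∀ u v → adj D u v ≡ adj D′ u v) →
  ∀ {k} → BalancedByDeleting G σ D k → BalancedByDeleting G τ D′ k
balancedByDeleting-cong {G = G} σ τ σ≈τ D D′ eq (D⊆G , size≡k , bal) =
    (λ {u} {v} e → D⊆G (subst T (sym (eq u v)) e))
  , trans (sym (size-cong D D′ eq)) size≡k
  , balanced-⊆ {σ = restrict (∖-⊆ G D) σ} {restrict (∖-⊆ G D′) τ} incl
      (λ e → trans (sym (σ≈τ (∖-⊆ G D′ e))) (cong (sign σ) (T-irrelevant _ _)))
      bal
  where
  incl : G ∖ D′ ⊆ G ∖ D
  incl {u} {v} = subst (λ a → T (adj G u v ∧ not a)) (sym (eq u v))

module _ {n} (G : Graph n) (σ : Signature G) where

  balancedByDeletingSome? : Decidable (BalancedByDeletingSome G σ)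
  balancedByDeletingSome? k =
    map′ (λ (f , p , b) → toGraph f p , b)
         (λ (D , b) → adj D , (adj-sym D , adj-irrefl D) , b)
         (search-matrix search-Bool n {Candidate} resp candidate?)
    where
    IsGraph : (Fin n → Fin n → Bool) → Set
    IsGraph f = (∀ u v → f u v ≡ f v u) × (∀ v → f v v ≡ false)

    toGraph : ∀ f → IsGraph f → Graph n
    toGraph f (s , i) = record { adj = f ; adj-sym = s ; adj-irrefl = i }

    Candidate : (Fin n → Fin n → Bool) → Set
    Candidate f = Σ (IsGraph f) λ p → BalancedByDeleting G σ (toGraph f p) k

    resp : ∀ {f g} → (∀ u v → f u v ≡ g u v) → Candidate f → Candidate g
    resp {f} {g} f≗g ((s , i) , b) =
      p , balancedByDeleting-cong σ σ (λ _ → refl) (toGraph f (s , i)) (toGraph g p) f≗g b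
      where
      p : IsGraph g
      p = (λ u v → trans (sym (f≗g u v)) (trans (s u v) (f≗g v u)))
        , (λ v → trans (sym (f≗g v v)) (i v))

    candidate? : Decidable Candidate
    candidate? f = Σ-dec
      (all? (λ u → all? λ v → f u v Bool.≟ f v u) ×-dec all? (λ v → f v v Bool.≟ false))
      (λ p → let D = toGraph f p in
        map′ (λ h {u} {v} → h u v) (λ h u v → h)
             (all? λ u → all? λ v → T? (adj D u v) →-dec T? (adj G u v))
        ×-dec size D ℕ.≟ k
        ×-dec balanced? (G ∖ D) (restrict (∖-⊆ G D) σ))
      (λ {p} {q} → balancedByDeleting-cong σ σ (λ _ → refl) (toGraph f p) (toGraph f q) (λ _ _ → refl))

  deletingAll : BalancedByDeletingSome G σ (size G)
  deletingAll = G , (λ e → e) , refl , λ c → ⊥-elim (absurd (adj G (last c) (first c)) (closing c))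
    where
    absurd : ∀ a → ¬ T (a ∧ not a)
    absurd true  ()
    absurd false ()

  -- Opaque, as is `maximumFrustration`: the value is fixed by the type, and
  -- unfolding it would run an exhaustive search.
  opaque
    minimumDeletion : ∃ (IsMinimum (BalancedByDeletingSome G σ))
    minimumDeletion = minimum balancedByDeletingSome? (size G , deletingAll)

  l : ℕ
  l = proj₁ minimumDeletion

  l-isMinimum : IsMinimum (BalancedByDeletingSome G σ) l
  l-isMinimum = proj₂ minimumDeletion

  l≤size : l ≤ size G
  l≤size = proj₂ l-isMinimum (size G) deletingAll

module _ {n} (G : Graph n) where

  l-mono : ∀ σ τ → σ ≈ τ → l G τ ≤ l G σ
  l-mono σ τ σ≈τ =
    let (D , b) , _ = l-isMinimum G σ in
    proj₂ (l-isMinimum G τ) _ (D , balancedByDeleting-cong σ τ σ≈τ D D (λ _ _ → refl) b)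

  l-cong : ∀ σ τ → σ ≈ τ → l G σ ≡ l G τ
  l-cong σ τ σ≈τ =
    ℕ.≤-antisym (l-mono τ σ (λ e → sym (σ≈τ e))) (l-mono σ τ σ≈τ)

  IsFrustrationIndex : ℕ → Set
  IsFrustrationIndex k = ∃[ σ ] l G σ ≡ k

  isFrustrationIndex? : Decidable IsFrustrationIndex
  isFrustrationIndex? k =
    map′ (λ (f , s , eq) → toSignature f s , eq)
         (λ (σ , eq) → extend σ , extend-sym σ , trans (l-cong _ σ (extend-sign σ)) eq)
         (search-matrix search-Sign n {Candidate} resp candidate?)
    where
    Symmetric : (Fin n → Fin n → Sign) → Set
    Symmetric f = ∀ u v → f u v ≡ f v u

    toSignature : ∀ f → Symmetric f → Signature G
    toSignature f s = record
      { sign = λ {u} {v} _ → f u v ; sign-sym = λ {u} {v} _ _ → s u v }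

    Candidate : (Fin n → Fin n → Sign) → Set
    Candidate f = Σ (Symmetric f) λ s → l G (toSignature f s) ≡ k

    resp : ∀ {f g} → (∀ u v → f u v ≡ g u v) → Candidate f → Candidate g
    resp f≗g (s , eq) =
        (λ u v → trans (sym (f≗g u v)) (trans (s u v) (f≗g v u)))
      , trans (l-cong _ _ λ {u} {v} _ → sym (f≗g u v)) eq

    candidate? : Decidable Candidate
    candidate? f = Σ-dec
      (all? λ u → all? λ v → f u v Sign.≟ f v u)
      (λ s → l G (toSignature f s) ℕ.≟ k)
      (trans (l-cong _ _ λ _ → refl))

    extend : Signature G → Fin n → Fin n → Sign
    extend σ u v with T? (adj G u v)
    ... | yes e = sign σ e
    ... | no  _ = +

    extend-sym : ∀ σ → Symmetric (extend σ)
    extend-sym σ u v with T? (adj G u v) | T? (adj G v u)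
    ... | yes e | yes e′ = sign-sym σ e e′
    ... | no _  | no _   = refl
    ... | yes e | no ¬e  = contradiction (subst T (adj-sym G u v) e) ¬e
    ... | no ¬e | yes e  = contradiction (subst T (adj-sym G v u) e) ¬e

    extend-sign : ∀ σ → toSignature (extend σ) (extend-sym σ) ≈ σ
    extend-sign σ {u} {v} e with T? (adj G u v)
    ... | yes e′ = cong (sign σ) (T-irrelevant e′ e)
    ... | no ¬e  = contradiction e ¬e

  opaque
    maximumFrustration : ∃ (IsMaximum IsFrustrationIndex)
    maximumFrustration = maximum isFrustrationIndex?
      (l G allNegative , allNegative , refl)
      (size G) (λ { _ (σ , refl) → l≤size G σ })

  lmax : ℕ
  lmax = proj₁ maximumFrustration

  lmax-isMaximum : IsMaximum IsFrustrationIndex lmax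
  lmax-isMaximum = proj₂ maximumFrustration

  AllNegativeMaximisesUniquely : Set
  AllNegativeMaximisesUniquely =
    l G allNegative ≡ lmax ×
    (∀ σ → l G σ ≡ lmax → SwitchingEquivalent σ allNegative)

{-# OPTIONS --safe #-}

-- Frustration indices are bounded above by building a switching function
-- greedily. Adding one vertex creates at most half its degree many negative
-- edges, and adding two vertices to a set of m at most m: first satisfy the edge
-- between the two, then negate both or neither. Write k = n - 1 and let a, b be
-- the two independent vertices. Starting from a path a v b of cost 0 and adding
-- the other k vertices in pairs, with a single one last if k is odd, gives
-- l ≤ k + ⌊k²/4⌋. A positive triangle also costs 0 and can be completed at cost
-- at most 2 to a set of five vertices containing a and b; going on in pairs from
-- there ends strictly below this bound. So if the bound is attained, all triangles
-- are negative, and since a clique vertex is adjacent to every other vertex,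
-- switching all its edges to negative makes every edge negative.
-- Conversely, a balanced subgraph of -S has no triangle, and Mantel's theorem
-- bounds its number of edges.
module Submission where

open import Defs

open import Algebra.Properties.CommutativeSemigroup using (interchange)
open import Data.Bool.Base using (Bool; true; false; T; not; _∧_; _xor_; if_then_else_)
open import Data.Bool.Properties using (T?; T-≡)
open import Data.Empty using (⊥; ⊥-elim)
open import Data.Fin.Base as Fin using (Fin; zero; suc; _↑ˡ_; _↑ʳ_; splitAt)
open import Data.Fin.Properties
  using (_<?_; _≟_; splitAt-↑ˡ; splitAt-↑ʳ; splitAt⁻¹-↑ˡ; splitAt⁻¹-↑ʳ)
open import Data.Integer.Base as ℤ using (+_; 1ℤ; _-_; _^_)
open import Data.Integer.DivMod using (div-pos-is-/ℕ)
import Data.Integer.Properties as ℤ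
open import Data.List.Base as List using (List; []; _∷_; _++_; map; allFin; tabulate)
open import Data.List.Membership.Propositional using (_∈_; find)
open import Data.List.Membership.Propositional.Properties using (∈-∃++; ∈-allFin)
open import Data.List.Properties
  using (map-tabulate; map-id; map-∘; map-++; ∷-injectiveˡ; ∷-injectiveʳ;
         length-map; length-tabulate; length-++)
open import Data.List.Relation.Binary.Permutation.Propositional as Perm
  using (_↭_; prep; ↭-refl; ↭-reflexive; ↭-sym; ↭-trans)
open import Data.List.Relation.Binary.Permutation.Propositional.Properties
  using (shift; ++-comm; map⁺; ↭-map-inv; ↭-length; ∈-resp-↭)
open import Data.List.Relation.Unary.All as All using (All; []; _∷_)
import Data.List.Relation.Unary.All.Properties as All
open import Data.List.Relation.Unary.AllPairs as AllPairs using (AllPairs; []; _∷_)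
import Data.List.Relation.Unary.AllPairs.Properties as AllPairs
open import Data.List.Relation.Unary.Any using (Any; here; there; any?)
open import Data.List.Relation.Unary.Unique.Propositional.Properties using (allFin⁺)
open import Data.Nat.Base as ℕ using (ℕ; zero; suc; _≤_; _<_; z≤n; s≤s; ⌊_/2⌋)
open import Data.Nat.Divisibility using (divides-refl)
open import Data.Nat.DivMod using (/-monoˡ-≤; +-distrib-/-∣ʳ; m*n/n≡m)
open import Data.Nat.ListAction using (sum)
open import Data.Nat.ListAction.Properties using (sum-↭)
open import Data.Nat.Properties as ℕ
  using (+-0-commutativeMonoid; +-commutativeSemigroup; *-mono-≤; +-mono-≤; +-monoˡ-≤;
         +-monoʳ-≤; +-mono-<-≤; ≤-refl; ≤-trans; ≤-antisym; n≤1+n; n<1+n; m≤n+m;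
         +-comm; +-assoc; +-suc; +-identityʳ; *-identityˡ; *-identityʳ; +-cancelˡ-≤;
         <⇒≱; ≰⇒>; <-irrefl; ⌊n/2⌋+⌈n/2⌉≡n; ⌊n/2⌋-mono; n≡⌊n+n/2⌋; module ≤-Reasoning)
open import Data.Nat.Tactic.RingSolver using (solve-∀)
open import Data.Product.Base using (∃-syntax; Σ-syntax; _×_; _,_; proj₁; proj₂)
open import Data.Rational.Unnormalised.Base using (_/_; _+_; floor)
open import Data.Sign.Base using (Sign; opposite) renaming (_*_ to _·_)
import Data.Sign.Properties as Sign
open import Data.Sum.Base using (_⊎_; inj₁; inj₂)
import Data.Vec.Base as Vec
open import Data.Vec.Properties using (lookup∘tabulate)
open import Function.Base using (_∘_; id)
open import Function.Bundles using (Equivalence)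
open import Relation.Binary.PropositionalEquality
  using (_≡_; _≢_; _≗_; refl; sym; trans; cong; cong₂; subst; module ≡-Reasoning)
open import Relation.Nullary using (¬_; yes; no; does; contradiction)

open import Algebra.Properties.CommutativeMonoid.Sum +-0-commutativeMonoid
  using (sum-syntax)

private variable
  A B : Set
  f g : A → A → ℕ

-- Quarter squares

⌊_²/4⌋ : ℕ → ℕ
⌊ k ²/4⌋ = k ℕ.* k ℕ./ 4

-- Since (k + 2)² = k² + 4(k + 1), the added multiple of 4 passes through the division. Both
-- Mantel's bound and the greedy bound grow by this recurrence when two vertices are added.
quarterSquare-+2 : ∀ k → ⌊ 2 ℕ.+ k ²/4⌋ ≡ ⌊ k ²/4⌋ ℕ.+ suc k
quarterSquare-+2 k = begin
  (2 ℕ.+ k) ℕ.* (2 ℕ.+ k) ℕ./ 4          ≡⟨ cong (ℕ._/ 4) (square k) ⟩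
  (k ℕ.* k ℕ.+ suc k ℕ.* 4) ℕ./ 4        ≡⟨ +-distrib-/-∣ʳ (k ℕ.* k) (divides-refl (suc k)) ⟩
  ⌊ k ²/4⌋ ℕ.+ suc k ℕ.* 4 ℕ./ 4         ≡⟨ cong (⌊ k ²/4⌋ ℕ.+_) (m*n/n≡m (suc k) 4) ⟩
  ⌊ k ²/4⌋ ℕ.+ suc k                     ∎
  where
  open ≡-Reasoning
  square : ∀ k → (2 ℕ.+ k) ℕ.* (2 ℕ.+ k) ≡ k ℕ.* k ℕ.+ suc k ℕ.* 4
  square = solve-∀

quarterSquare-mono : ∀ {j k} → j ≤ k → ⌊ j ²/4⌋ ≤ ⌊ k ²/4⌋
quarterSquare-mono j≤k = /-monoˡ-≤ 4 (*-mono-≤ j≤k j≤k)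

-- Sums over the unordered pairs of entries of a list

sum-map-+ : ∀ (f g : A → ℕ) xs →
            sum (map (λ x → f x ℕ.+ g x) xs) ≡ sum (map f xs) ℕ.+ sum (map g xs)
sum-map-+ f g []       = refl
sum-map-+ f g (x ∷ xs) = trans (cong (f x ℕ.+ g x ℕ.+_) (sum-map-+ f g xs))
  (interchange +-commutativeSemigroup (f x) (g x) _ _)

sum-map-cong : ∀ {f g : A → ℕ} → f ≗ g → ∀ xs → sum (map f xs) ≡ sum (map g xs)
sum-map-cong f≗g []       = refl
sum-map-cong f≗g (x ∷ xs) = cong₂ ℕ._+_ (f≗g x) (sum-map-cong f≗g xs)

sum-map-≤length : ∀ {f : A → ℕ} → (∀ x → f x ≤ 1) → ∀ xs → sum (map f xs) ≤ List.length xs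
sum-map-≤length f≤1 []       = z≤n
sum-map-≤length f≤1 (x ∷ xs) = +-mono-≤ (f≤1 x) (sum-map-≤length f≤1 xs)

sum-map-≤ : ∀ {f g : A → ℕ} → (∀ x → f x ≤ g x) → ∀ xs → sum (map f xs) ≤ sum (map g xs)
sum-map-≤ f≤g []       = z≤n
sum-map-≤ f≤g (x ∷ xs) = +-mono-≤ (f≤g x) (sum-map-≤ f≤g xs)

sum-map-≡length : ∀ {f : A → ℕ} {xs} → All (λ x → f x ≡ 1) xs → sum (map f xs) ≡ List.length xs
sum-map-≡length []         = refl
sum-map-≡length (eq ∷ eqs) = cong₂ ℕ._+_ eq (sum-map-≡length eqs)

sum-map-≡0 : ∀ {f : A → ℕ} {xs} → All (λ x → f x ≡ 0) xs → sum (map f xs) ≡ 0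
sum-map-≡0 []         = refl
sum-map-≡0 (eq ∷ eqs) = cong₂ ℕ._+_ eq (sum-map-≡0 eqs)

pairSum : (A → A → ℕ) → List A → ℕ
pairSum f []       = 0
pairSum f (x ∷ xs) = sum (map (f x) xs) ℕ.+ pairSum f xs

pairSum-+ : ∀ (f g : A → A → ℕ) xs →
            pairSum (λ x y → f x y ℕ.+ g x y) xs ≡ pairSum f xs ℕ.+ pairSum g xs
pairSum-+ f g []       = refl
pairSum-+ f g (x ∷ xs) = trans
  (cong₂ ℕ._+_ (sum-map-+ (f x) (g x) xs) (pairSum-+ f g xs))
  (interchange +-commutativeSemigroup (sum (map (f x) xs)) _ _ _)

pairSum-cong : (∀ x y → f x y ≡ g x y) → ∀ xs → pairSum f xs ≡ pairSum g xs
pairSum-cong f≗g []       = refl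
pairSum-cong f≗g (x ∷ xs) = cong₂ ℕ._+_ (sum-map-cong (f≗g x) xs) (pairSum-cong f≗g xs)

pairSum-map : ∀ (f : B → B → ℕ) (h : A → B) xs →
              pairSum f (map h xs) ≡ pairSum (λ x y → f (h x) (h y)) xs
pairSum-map f h []       = refl
pairSum-map f h (x ∷ xs) = cong₂ ℕ._+_ (cong sum (sym (map-∘ xs))) (pairSum-map f h xs)

pairSum-↭ : (∀ x y → f x y ≡ f y x) → ∀ {xs ys} → xs ↭ ys → pairSum f xs ≡ pairSum f ys
pairSum-↭ f-sym Perm.refl        = refl
pairSum-↭ {f = f} f-sym (prep x p) =
  cong₂ ℕ._+_ (sum-↭ (map⁺ (f x) p)) (pairSum-↭ f-sym p)
pairSum-↭ {f = f} f-sym (Perm.swap {xs} {ys} x y p) = begin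
  (f x y ℕ.+ sum (map (f x) xs)) ℕ.+ (sum (map (f y) xs) ℕ.+ pairSum f xs)
    ≡⟨ interchange +-commutativeSemigroup (f x y) _ _ _ ⟩
  (f x y ℕ.+ sum (map (f y) xs)) ℕ.+ (sum (map (f x) xs) ℕ.+ pairSum f xs)
    ≡⟨ cong₂ ℕ._+_ (cong₂ ℕ._+_ (f-sym x y) (sum-↭ (map⁺ (f y) p)))
                   (cong₂ ℕ._+_ (sum-↭ (map⁺ (f x) p)) (pairSum-↭ f-sym p)) ⟩
  (f y x ℕ.+ sum (map (f y) ys)) ℕ.+ (sum (map (f x) ys) ℕ.+ pairSum f ys) ∎
  where open ≡-Reasoning
pairSum-↭ f-sym (Perm.trans p q) = trans (pairSum-↭ f-sym p) (pairSum-↭ f-sym q)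

∈⇒↭∷ : ∀ {x : A} {xs} → x ∈ xs → ∃[ ys ] xs ↭ x ∷ ys
∈⇒↭∷ x∈xs with ys , zs , refl ← ∈-∃++ x∈xs = ys ++ zs , shift _ ys zs

-- The binomial coefficient m(m - 1)/2 is written as two consecutive quarter squares, so that it can
-- later be compared with Mantel's bound without division. The induction step is the recurrence for
-- quarter squares.
pairSum-complete : ∀ {xs} → AllPairs (λ x y → f x y ≡ 1) xs →
                   pairSum f xs ≡ ⌊ List.length xs ²/4⌋ ℕ.+ ⌊ ℕ.pred (List.length xs) ²/4⌋
pairSum-complete []       = refl
pairSum-complete {f = f} {xs = x ∷ xs} (eqs ∷ pairs) = begin
  sum (map (f x) xs) ℕ.+ pairSum f xs
    ≡⟨ cong₂ ℕ._+_ (sum-map-≡length eqs) (pairSum-complete pairs) ⟩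
  m ℕ.+ (⌊ m ²/4⌋ ℕ.+ ⌊ ℕ.pred m ²/4⌋)
    ≡⟨ step m ⟩
  ⌊ suc m ²/4⌋ ℕ.+ ⌊ m ²/4⌋ ∎
  where
  open ≡-Reasoning
  m = List.length xs
  arith : ∀ j p q → suc j ℕ.+ (p ℕ.+ q) ≡ (q ℕ.+ suc j) ℕ.+ p
  arith = solve-∀
  step : ∀ m → m ℕ.+ (⌊ m ²/4⌋ ℕ.+ ⌊ ℕ.pred m ²/4⌋) ≡ ⌊ suc m ²/4⌋ ℕ.+ ⌊ m ²/4⌋
  step zero    = refl
  step (suc j) = trans (arith j ⌊ suc j ²/4⌋ ⌊ j ²/4⌋)
                       (cong (ℕ._+ ⌊ suc j ²/4⌋) (sym (quarterSquare-+2 j)))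

-- Indicators and Mantel's theorem

𝟙 : Bool → ℕ
𝟙 b = if b then 1 else 0

𝟙≤1 : ∀ b → 𝟙 b ≤ 1
𝟙≤1 true  = ≤-refl
𝟙≤1 false = z≤n

-- Mantel's theorem: every vertex outside an edge is joined to at most one of its ends.
mantel : ∀ (adj : A → A → Bool) →
         (∀ u v → adj u v ≡ adj v u) →
         (∀ u v w → T (adj u v) → T (adj u w) → T (adj v w) → ⊥) →
         ∀ us → pairSum (λ u v → 𝟙 (adj u v)) us ≤ ⌊ List.length us ²/4⌋
mantel adj adj-sym triangle-free us = bound (List.length us) us ≤-refl
  where
  e : _ → _ → ℕ
  e u v = 𝟙 (adj u v)

  disjoint : ∀ u v → T (adj u v) → ∀ w → e u w ℕ.+ e v w ≤ 1
  disjoint u v uv w with adj u w in uw | adj v w in vw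
  ... | false | b     = 𝟙≤1 b
  ... | true  | false = ≤-refl
  ... | true  | true  = contradiction (subst T (sym vw) _) (triangle-free u v w uv (subst T (sym uw) _))

  ¬T⇒𝟙≡0 : ∀ b → ¬ T b → 𝟙 b ≡ 0
  ¬T⇒𝟙≡0 true  ¬b = contradiction _ ¬b
  ¬T⇒𝟙≡0 false ¬b = refl

  -- The recursion runs on a bound `k` for the length, because removing both ends of an edge leaves
  -- a list that is not a structural part of the original.
  bound : ∀ k us → List.length us ≤ k → pairSum e us ≤ ⌊ List.length us ²/4⌋
  bound k       []       _        = z≤n
  bound (suc k) (u ∷ us) (s≤s ≤k) with any? (λ v → T? (adj u v)) us
  ... | no isolated = begin
    sum (map (e u) us) ℕ.+ pairSum e us  ≡⟨ cong (ℕ._+ pairSum e us)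
                                              (sum-map-≡0 (All.map (¬T⇒𝟙≡0 _) (All.¬Any⇒All¬ us isolated))) ⟩
    pairSum e us                         ≤⟨ bound k us ≤k ⟩
    ⌊ List.length us ²/4⌋                ≤⟨ quarterSquare-mono (n≤1+n (List.length us)) ⟩
    ⌊ suc (List.length us) ²/4⌋          ∎
    where open ≤-Reasoning
  ... | yes neighbour
    with v , v∈us , uv ← find neighbour
    with ws , us↭v∷ws ← ∈⇒↭∷ v∈us
    = begin
    pairSum e (u ∷ us)
      ≡⟨ pairSum-↭ (λ x y → cong 𝟙 (adj-sym x y)) (prep u us↭v∷ws) ⟩
    (e u v ℕ.+ sum (map (e u) ws)) ℕ.+ (sum (map (e v) ws) ℕ.+ pairSum e ws)
      ≡⟨ regroup (e u v) (sum (map (e u) ws)) (sum (map (e v) ws)) (pairSum e ws) ⟩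
    pairSum e ws ℕ.+ (e u v ℕ.+ (sum (map (e u) ws) ℕ.+ sum (map (e v) ws)))
      ≡⟨ cong (λ d → pairSum e ws ℕ.+ (e u v ℕ.+ d)) (sym (sum-map-+ (e u) (e v) ws)) ⟩
    pairSum e ws ℕ.+ (e u v ℕ.+ sum (map (λ w → e u w ℕ.+ e v w) ws))
      ≤⟨ +-mono-≤ (bound k ws (≤-trans (n≤1+n _) (subst (_≤ k) (↭-length us↭v∷ws) ≤k)))
                  (+-mono-≤ (𝟙≤1 _) (sum-map-≤length (disjoint u v uv) ws)) ⟩
    ⌊ List.length ws ²/4⌋ ℕ.+ suc (List.length ws)
      ≡⟨ quarterSquare-+2 (List.length ws) ⟨
    ⌊ 2 ℕ.+ List.length ws ²/4⌋
      ≡⟨ cong (λ m → ⌊ suc m ²/4⌋) (sym (↭-length us↭v∷ws)) ⟩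
    ⌊ suc (List.length us) ²/4⌋ ∎
    where
    open ≤-Reasoning
    regroup : ∀ a b c d → (a ℕ.+ b) ℕ.+ (c ℕ.+ d) ≡ d ℕ.+ (a ℕ.+ (b ℕ.+ c))
    regroup = solve-∀

-- Edge counts

∑-tabulate : ∀ n (f : A → ℕ) (h : Fin n → A) → ∑[ i < n ] f (h i) ≡ sum (map f (tabulate h))
∑-tabulate zero    f h = refl
∑-tabulate (suc n) f h = cong (f (h zero) ℕ.+_) (∑-tabulate n f (h ∘ suc))

∑-< : ∀ n (b : Fin n → Fin n → Bool) →
      ∑[ u < n ] ∑[ v < n ] 𝟙 (does (u <? v) ∧ b u v) ≡ pairSum (λ u v → 𝟙 (b u v)) (allFin n)
∑-< zero    b = refl
-- By computation, the row of `zero` keeps exactly its entries at successors, and every other row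
-- loses its entry at `zero`.
∑-< (suc n) b = cong₂ ℕ._+_ (∑-tabulate n (λ v → 𝟙 (b zero v)) suc) (begin
  ∑[ u < n ] ∑[ v < n ] 𝟙 (does (u <? v) ∧ b (suc u) (suc v))
    ≡⟨ ∑-< n (λ u v → b (suc u) (suc v)) ⟩
  pairSum (λ u v → 𝟙 (b (suc u) (suc v))) (allFin n)
    ≡⟨ pairSum-map (λ u v → 𝟙 (b u v)) suc (allFin n) ⟨
  pairSum (λ u v → 𝟙 (b u v)) (map suc (allFin n))
    ≡⟨ cong (pairSum (λ u v → 𝟙 (b u v))) (map-tabulate {n = n} id Fin.suc) ⟩
  pairSum (λ u v → 𝟙 (b u v)) (tabulate suc) ∎)
  where open ≡-Reasoning

size≡pairSum : ∀ {n} (G : Graph n) → size G ≡ pairSum (λ u v → 𝟙 (adj G u v)) (allFin n)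
size≡pairSum {n} G = ∑-< n (adj G)

size-∖ : ∀ {n} (G D : Graph n) → D ⊆ G → size G ≡ size (G ∖ D) ℕ.+ size D
size-∖ {n} G D D⊆G = begin
  size G
    ≡⟨ size≡pairSum G ⟩
  pairSum (λ u v → 𝟙 (adj G u v)) (allFin n)
    ≡⟨ pairSum-cong (λ u v → split (adj G u v) (adj D u v) D⊆G) (allFin n) ⟩
  pairSum (λ u v → 𝟙 (adj (G ∖ D) u v) ℕ.+ 𝟙 (adj D u v)) (allFin n)
    ≡⟨ pairSum-+ (λ u v → 𝟙 (adj (G ∖ D) u v)) (λ u v → 𝟙 (adj D u v)) (allFin n) ⟩
  pairSum (λ u v → 𝟙 (adj (G ∖ D) u v)) (allFin n) ℕ.+ pairSum (λ u v → 𝟙 (adj D u v)) (allFin n)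
    ≡⟨ cong₂ ℕ._+_ (size≡pairSum (G ∖ D)) (size≡pairSum D) ⟨
  size (G ∖ D) ℕ.+ size D ∎
  where
  open ≡-Reasoning
  split : ∀ a d → (T d → T a) → 𝟙 a ≡ 𝟙 (a ∧ not d) ℕ.+ 𝟙 d
  split true  true  _   = refl
  split true  false _   = refl
  split false false _   = refl
  split false true  d⇒a = contradiction (d⇒a _) id

-- Greedy switching

negative : Sign → Bool
negative Sign.+ = false
negative Sign.- = true

-- Here `b` is an adjacency and `s` the product of the switching values at its two ends; the result
-- says that an edge is present and negative after switching. Abstracting `b` allows matching on it
-- although signs depend on adjacency proofs.
conflict : (b : Bool) → (T b → Sign) → Sign → Bool
conflict false _    _ = false
conflict true  sign s = negative (sign _ · s)

conflict-cong : ∀ {b b′ g g′} → b ≡ b′ → (∀ e e′ → g e ≡ g′ e′) →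
                ∀ s → conflict b g s ≡ conflict b′ g′ s
conflict-cong {false} refl g≗g′ s = refl
conflict-cong {true}  refl g≗g′ s rewrite g≗g′ _ _ = refl

conflict-edge : ∀ b {g s} (e : T b) → conflict b g s ≡ negative (g e · s)
conflict-edge true e = refl

conflict-⊆ : ∀ b {g s} → T (conflict b g s) → T b
conflict-⊆ true _ = _

no-edge⇒no-conflict : ∀ {b} g s → b ≡ false → conflict b g s ≡ false
no-edge⇒no-conflict g s refl = refl

no-conflict⇒≡ : ∀ b {g s} → (e : T b) → T (b ∧ not (conflict b g s)) → g e ≡ s
no-conflict⇒≡ true {g} {s} e _ with g _ in eq
no-conflict⇒≡ true {s = Sign.+} e _ | Sign.+ = eq
no-conflict⇒≡ true {s = Sign.-} e _ | Sign.- = eq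

conflict-agree : ∀ b {g} (e : T b) → 𝟙 (conflict b g (g e)) ≡ 0
conflict-agree true {g} e = cong (𝟙 ∘ negative) (Sign.s*s≡+ (g e))

-- An edge disagrees with exactly one of two opposite signs. This is the averaging behind both
-- greedy steps.
conflict-± : ∀ b g t → 𝟙 (conflict b g t) ℕ.+ 𝟙 (conflict b g (opposite t)) ≡ 𝟙 b
conflict-± false g t = refl
conflict-± true  g t with g _
conflict-± true  g Sign.+ | Sign.+ = refl
conflict-± true  g Sign.- | Sign.+ = refl
conflict-± true  g Sign.+ | Sign.- = refl
conflict-± true  g Sign.- | Sign.- = refl

-- Used to read a list of signed vertices that covers every vertex once, in order, as a total
-- switching function.
tabulate-values : ∀ {A B : Set} {m} (h : Fin m → A) (ps : List (A × B)) →
                  tabulate h ≡ map proj₁ ps →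
                  Σ[ x ∈ (Fin m → B) ] ps ≡ tabulate (λ i → h i , x i)
tabulate-values {m = zero}  h []             eq = (λ ()) , refl
tabulate-values {m = suc m} h ((u , s) ∷ ps) eq
  with x , eq′ ← tabulate-values (h ∘ suc) ps (∷-injectiveʳ eq)
  = (λ { zero → s ; (suc i) → x i }) , cong₂ _∷_ (cong (_, s) (sym (∷-injectiveˡ eq))) eq′

-- If both failed, the sum would be at least 2⌊d/2⌋ + 2, which exceeds d.
+≤⇒≤half : ∀ {a b d} → a ℕ.+ b ≤ d → a ≤ ⌊ d /2⌋ ⊎ b ≤ ⌊ d /2⌋
+≤⇒≤half {a} {b} {d} a+b≤d with a ℕ.≤? ⌊ d /2⌋ | b ℕ.≤? ⌊ d /2⌋
... | yes a≤ | _      = inj₁ a≤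
... | no _   | yes b≤ = inj₂ b≤
... | no a≰  | no b≰  = contradiction a+b≤d (<⇒≱ (begin-strict
  d                              ≡⟨ ⌊n/2⌋+⌈n/2⌉≡n d ⟨
  ⌊ d /2⌋ ℕ.+ ℕ.⌈ d /2⌉          ≤⟨ +-monoʳ-≤ ⌊ d /2⌋ (⌊n/2⌋-mono (n≤1+n (suc d))) ⟩
  ⌊ d /2⌋ ℕ.+ suc ⌊ d /2⌋        <⟨ +-mono-<-≤ (≰⇒> a≰) (≰⇒> b≰) ⟩
  a ℕ.+ b                        ∎))
  where open ≤-Reasoning

⌊1+2j/2⌋ : ∀ j → ⌊ suc (j ℕ.+ j) /2⌋ ≡ j
⌊1+2j/2⌋ zero    = refl
⌊1+2j/2⌋ (suc j) = cong suc (trans (cong ⌊_/2⌋ (+-suc j j)) (⌊1+2j/2⌋ j))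

module _ {n} (G : Graph n) (σ : Signature G) where

  deletion : (Fin n → Sign) → Graph n
  deletion x = record
    { adj        = λ u v → conflict (adj G u v) (sign σ) (x u · x v)
    ; adj-sym    = λ u v → trans (conflict-cong (adj-sym G u v) (sign-sym σ) (x u · x v))
                                 (cong (conflict (adj G v u) (sign σ)) (Sign.*-comm (x u) (x v)))
    ; adj-irrefl = λ v → no-edge⇒no-conflict (sign σ) (x v · x v) (adj-irrefl G v)
    }

  -- Each edge that remains has sign `x u · x v`, so the sign of a walk telescopes to the product of
  -- the values at its ends. Around a cycle this product meets an equal one from the closing edge,
  -- and the square is `+`.
  l≤size-deletion : ∀ x → l G σ ≤ size (deletion x)
  l≤size-deletion x = proj₂ (l-isMinimum G σ) _
    (D , (λ {u} {v} → conflict-⊆ (adj G u v)) , refl , balanced)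
    where
    D = deletion x
    τ = restrict (∖-⊆ G D) σ

    edge : ∀ {u v} (e : G ∖ D [ u ~ v ]) → sign τ e ≡ x u · x v
    edge {u} {v} e = no-conflict⇒≡ (adj G u v) (∖-⊆ G D e) e

    telescope : ∀ {u v} (w : Walk (G ∖ D) u v) → walkSign τ w ≡ x u · x v
    telescope {u} []                = sym (Sign.s*s≡+ (x u))
    telescope {u} {v} (_∷_ {v = t} e w) = begin
      sign τ e · walkSign τ w          ≡⟨ cong₂ _·_ (edge e) (telescope w) ⟩
      (x u · x t) · (x t · x v)        ≡⟨ cancel (x u) (x t) (x v) ⟩
      x u · x v                        ∎
      where
      open ≡-Reasoning
      cancel : ∀ r s t → (r · s) · (s · t) ≡ r · t
      cancel r s t = trans (Sign.*-assoc r s (s · t))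
        (cong (r ·_) (trans (sym (Sign.*-assoc s s t)) (cong (_· t) (Sign.s*s≡+ s))))

    balanced : Balanced (G ∖ D) τ
    balanced c = trans (cong₂ _·_ (edge (closing c)) (telescope (path c))) (begin
      (x t · x s) · (x s · x t)   ≡⟨ cong ((x t · x s) ·_) (Sign.*-comm (x s) (x t)) ⟩
      (x t · x s) · (x t · x s)   ≡⟨ Sign.s*s≡+ (x t · x s) ⟩
      Sign.+                      ∎)
      where
      open ≡-Reasoning
      s = first c
      t = last c

  -- A list of vertices with signs is a partial switching function, and its cost
  -- is the number of edges among its vertices that this switching makes negative.
  clash : Fin n × Sign → Fin n × Sign → ℕ
  clash (u , s) (v , t) = 𝟙 (conflict (adj G u v) (sign σ) (s · t))

  cost : List (Fin n × Sign) → ℕ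
  cost = pairSum clash

  edges : Fin n → List (Fin n) → ℕ
  edges u vs = sum (map (λ v → 𝟙 (adj G u v)) vs)

  clash-sym : ∀ p q → clash p q ≡ clash q p
  clash-sym (u , s) (v , t) = cong 𝟙
    (trans (conflict-cong (adj-sym G u v) (sign-sym σ) (s · t))
           (cong (conflict (adj G v u) (sign σ)) (Sign.*-comm s t)))

  -- Once permuted into the order of `allFin`, the list is the graph of a total switching function.
  -- The cost is unchanged because `clash` is symmetric.
  l≤cost : ∀ ps → map proj₁ ps ↭ allFin n → l G σ ≤ cost ps
  l≤cost ps all
    with qs , eq , ps↭qs ← ↭-map-inv proj₁ all
    with x , refl ← tabulate-values id qs eq
    = begin
    l G σ                                              ≤⟨ l≤size-deletion x ⟩
    size (deletion x)                                  ≡⟨ size≡pairSum (deletion x) ⟩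
    pairSum (λ u v → clash (u , x u) (v , x v)) (allFin n)
                                                       ≡⟨ pairSum-map clash (λ i → i , x i) (allFin n) ⟨
    cost (map (λ i → i , x i) (allFin n))              ≡⟨ cong cost (map-tabulate id (λ i → i , x i)) ⟩
    cost (tabulate (λ i → i , x i))                    ≡⟨ pairSum-↭ clash-sym ps↭qs ⟨
    cost ps                                            ∎
    where open ≤-Reasoning

  -- Every edge from `u` into the list clashes for exactly one choice of `s`, so the better choice
  -- clashes with at most half of these edges.
  add-vertex : ∀ u ps d → edges u (map proj₁ ps) ≤ d →
               ∃[ s ] cost ((u , s) ∷ ps) ≤ ⌊ d /2⌋ ℕ.+ cost ps
  add-vertex u ps d edges≤d = choose (+≤⇒≤half (subst (_≤ d) (sym both) edges≤d))
    where
    into : Sign → ℕ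
    into s = sum (map (clash (u , s)) ps)

    both : into Sign.+ ℕ.+ into Sign.- ≡ edges u (map proj₁ ps)
    both = begin
      into Sign.+ ℕ.+ into Sign.-
        ≡⟨ sum-map-+ (clash (u , Sign.+)) (clash (u , Sign.-)) ps ⟨
      sum (map (λ p → clash (u , Sign.+) p ℕ.+ clash (u , Sign.-) p) ps)
        ≡⟨ sum-map-cong (λ (v , t) → conflict-± (adj G u v) (sign σ) t) ps ⟩
      sum (map (λ p → 𝟙 (adj G u (proj₁ p))) ps)
        ≡⟨ cong sum (map-∘ ps) ⟩
      edges u (map proj₁ ps) ∎
      where open ≡-Reasoning

    choose : into Sign.+ ≤ ⌊ d /2⌋ ⊎ into Sign.- ≤ ⌊ d /2⌋ →
             ∃[ s ] cost ((u , s) ∷ ps) ≤ ⌊ d /2⌋ ℕ.+ cost ps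
    choose (inj₁ ≤half) = Sign.+ , +-monoˡ-≤ (cost ps) ≤half
    choose (inj₂ ≤half) = Sign.- , +-monoˡ-≤ (cost ps) ≤half

  -- With the edge uv satisfied, negating both values complements the clashes
  -- of u and v with the rest.
  add-pair : ∀ u v ps → ∃[ s ] ∃[ t ] cost ((u , s) ∷ (v , t) ∷ ps) ≤ List.length ps ℕ.+ cost ps
  add-pair u v ps = choose (agreeing (adj G u v) (sign σ))
    where
    agreeing : ∀ b g → ∃[ s ] 𝟙 (conflict b g s) ≡ 0
    -- Without an edge `uv` nothing constrains the product of the two values, and `+` is a default.
    agreeing false g = Sign.+ , refl
    agreeing true  g = g _ , conflict-agree true {g} _

    choose : ∃[ r ] 𝟙 (conflict (adj G u v) (sign σ) r) ≡ 0 →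
             ∃[ s ] ∃[ t ] cost ((u , s) ∷ (v , t) ∷ ps) ≤ List.length ps ℕ.+ cost ps
    choose (r , agrees) = pick (+≤⇒≤half both)
      where
      m = List.length ps

      into : Sign → ℕ
      into s = sum (map (λ p → clash (u , s) p ℕ.+ clash (v , s · r) p) ps)

      complementary : ∀ p → (clash (u , Sign.+) p ℕ.+ clash (v , r) p) ℕ.+
                            (clash (u , Sign.-) p ℕ.+ clash (v , opposite r) p) ≤ 1 ℕ.+ 1
      complementary (w , q) = begin
        (c u q ℕ.+ c v (r · q)) ℕ.+ (c u (opposite q) ℕ.+ c v (opposite r · q))
          ≡⟨ interchange +-commutativeSemigroup (c u q) _ _ _ ⟩
        (c u q ℕ.+ c u (opposite q)) ℕ.+ (c v (r · q) ℕ.+ c v (opposite r · q))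
          ≡⟨ cong (λ t → (c u q ℕ.+ c u (opposite q)) ℕ.+ (c v (r · q) ℕ.+ c v t)) (Sign.*-assoc Sign.- r q) ⟩
        (c u q ℕ.+ c u (opposite q)) ℕ.+ (c v (r · q) ℕ.+ c v (opposite (r · q)))
          ≡⟨ cong₂ ℕ._+_ (conflict-± (adj G u w) (sign σ) q) (conflict-± (adj G v w) (sign σ) (r · q)) ⟩
        𝟙 (adj G u w) ℕ.+ 𝟙 (adj G v w)
          ≤⟨ +-mono-≤ (𝟙≤1 (adj G u w)) (𝟙≤1 (adj G v w)) ⟩
        2 ∎
        where
        open ≤-Reasoning
        c : Fin n → Sign → ℕ
        c y t = 𝟙 (conflict (adj G y w) (sign σ) t)

      both : into Sign.+ ℕ.+ into Sign.- ≤ m ℕ.+ m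
      both = begin
        into Sign.+ ℕ.+ into Sign.-
          ≡⟨ sum-map-+ (λ p → clash (u , Sign.+) p ℕ.+ clash (v , r) p)
                       (λ p → clash (u , Sign.-) p ℕ.+ clash (v , opposite r) p) ps ⟨
        sum (map (λ p → (clash (u , Sign.+) p ℕ.+ clash (v , r) p) ℕ.+
                        (clash (u , Sign.-) p ℕ.+ clash (v , opposite r) p)) ps)
          ≤⟨ sum-map-≤ complementary ps ⟩
        sum (map (λ _ → 1 ℕ.+ 1) ps)
          ≡⟨ sum-map-+ (λ _ → 1) (λ _ → 1) ps ⟩
        sum (map (λ _ → 1) ps) ℕ.+ sum (map (λ _ → 1) ps)
          ≡⟨ cong₂ ℕ._+_ ones ones ⟩
        m ℕ.+ m ∎
        where
        open ≤-Reasoning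
        ones = sum-map-≡length (All.universal (λ _ → refl) ps)

      total : ∀ s → into s ≤ m → cost ((u , s) ∷ (v , s · r) ∷ ps) ≤ m ℕ.+ cost ps
      total s ≤m = begin
        (clash (u , s) (v , s · r) ℕ.+ sum (map (clash (u , s)) ps)) ℕ.+
        (sum (map (clash (v , s · r)) ps) ℕ.+ cost ps)
          ≡⟨ cong (λ z → (z ℕ.+ sum (map (clash (u , s)) ps)) ℕ.+
                         (sum (map (clash (v , s · r)) ps) ℕ.+ cost ps)) satisfied ⟩
        sum (map (clash (u , s)) ps) ℕ.+ (sum (map (clash (v , s · r)) ps) ℕ.+ cost ps)
          ≡⟨ +-assoc (sum (map (clash (u , s)) ps)) _ _ ⟨
        (sum (map (clash (u , s)) ps) ℕ.+ sum (map (clash (v , s · r)) ps)) ℕ.+ cost ps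
          ≡⟨ cong (ℕ._+ cost ps) (sum-map-+ (clash (u , s)) (clash (v , s · r)) ps) ⟨
        into s ℕ.+ cost ps
          ≤⟨ +-monoˡ-≤ (cost ps) ≤m ⟩
        m ℕ.+ cost ps ∎
        where
        open ≤-Reasoning
        satisfied : clash (u , s) (v , s · r) ≡ 0
        satisfied = trans (cong (λ t → 𝟙 (conflict (adj G u v) (sign σ) t))
          (trans (sym (Sign.*-assoc s s r)) (cong (_· r) (Sign.s*s≡+ s)))) agrees

      pick : into Sign.+ ≤ ⌊ m ℕ.+ m /2⌋ ⊎ into Sign.- ≤ ⌊ m ℕ.+ m /2⌋ →
             ∃[ s ] ∃[ t ] cost ((u , s) ∷ (v , t) ∷ ps) ≤ m ℕ.+ cost ps
      pick (inj₁ ≤m) = Sign.+ , r , total Sign.+ (subst (into Sign.+ ≤_) (sym (n≡⌊n+n/2⌋ m)) ≤m)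
      pick (inj₂ ≤m) = Sign.- , opposite r , total Sign.- (subst (into Sign.- ≤_) (sym (n≡⌊n+n/2⌋ m)) ≤m)

  -- The recursion reaches the end of `us` before adding anything, so an unpaired vertex joins
  -- first, at cost ⌊(2j + 1)/2⌋ = j; the odd size of `ps` makes this half round down. A pair added
  -- after m others costs at most m + 2j + 1, which is the increase of the bound from m to m + 2.
  extend : ∀ j us ps → List.length ps ≡ suc (j ℕ.+ j) →
           ∃[ qs ] map proj₁ qs ≡ us ++ map proj₁ ps ×
                   cost qs ≤ (j ℕ.* List.length us ℕ.+ ⌊ List.length us ²/4⌋) ℕ.+ cost ps
  extend j []       ps odd = ps , refl , m≤n+m (cost ps) _
  extend j (u ∷ []) ps odd
    with s , ≤half ← add-vertex u ps (List.length ps)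
           (subst (edges u (map proj₁ ps) ≤_) (length-map proj₁ ps)
             (sum-map-≤length (λ v → 𝟙≤1 (adj G u v)) (map proj₁ ps)))
    = (u , s) ∷ ps , refl , (begin
    cost ((u , s) ∷ ps)                      ≤⟨ ≤half ⟩
    ⌊ List.length ps /2⌋ ℕ.+ cost ps         ≡⟨ cong (λ m → ⌊ m /2⌋ ℕ.+ cost ps) odd ⟩
    ⌊ suc (j ℕ.+ j) /2⌋ ℕ.+ cost ps          ≡⟨ cong (ℕ._+ cost ps) (⌊1+2j/2⌋ j) ⟩
    j ℕ.+ cost ps                            ≡⟨ cong (ℕ._+ cost ps) (trans (+-identityʳ _) (*-identityʳ j)) ⟨
    (j ℕ.* 1 ℕ.+ ⌊ 1 ²/4⌋) ℕ.+ cost ps       ∎)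
    where open ≤-Reasoning
  extend j (u ∷ v ∷ us) ps odd
    with qs , covers , bound ← extend j us ps odd
    with s , t , ≤pair ← add-pair u v qs
    = (u , s) ∷ (v , t) ∷ qs , cong (λ vs → u ∷ v ∷ vs) covers , (begin
    cost ((u , s) ∷ (v , t) ∷ qs)
      ≤⟨ ≤pair ⟩
    List.length qs ℕ.+ cost qs
      ≤⟨ +-monoʳ-≤ (List.length qs) bound ⟩
    List.length qs ℕ.+ ((j ℕ.* m ℕ.+ ⌊ m ²/4⌋) ℕ.+ cost ps)
      ≡⟨ cong (ℕ._+ ((j ℕ.* m ℕ.+ ⌊ m ²/4⌋) ℕ.+ cost ps)) len ⟩
    (m ℕ.+ suc (j ℕ.+ j)) ℕ.+ ((j ℕ.* m ℕ.+ ⌊ m ²/4⌋) ℕ.+ cost ps)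
      ≡⟨ regroup j m ⌊ m ²/4⌋ (cost ps) ⟩
    (j ℕ.* (2 ℕ.+ m) ℕ.+ (⌊ m ²/4⌋ ℕ.+ suc m)) ℕ.+ cost ps
      ≡⟨ cong (λ q → (j ℕ.* (2 ℕ.+ m) ℕ.+ q) ℕ.+ cost ps) (quarterSquare-+2 m) ⟨
    (j ℕ.* (2 ℕ.+ m) ℕ.+ ⌊ 2 ℕ.+ m ²/4⌋) ℕ.+ cost ps ∎)
    where
    open ≤-Reasoning
    m = List.length us
    len : List.length qs ≡ m ℕ.+ suc (j ℕ.+ j)
    len = trans (sym (length-map proj₁ qs)) (trans (cong List.length covers)
          (trans (length-++ us) (cong (m ℕ.+_) (trans (length-map proj₁ ps) odd))))
    regroup : ∀ j m q c → (m ℕ.+ suc (j ℕ.+ j)) ℕ.+ ((j ℕ.* m ℕ.+ q) ℕ.+ c) ≡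
                          (j ℕ.* (2 ℕ.+ m) ℕ.+ (q ℕ.+ suc m)) ℕ.+ c
    regroup = solve-∀

  l≤extend : ∀ j us ps → List.length ps ≡ suc (j ℕ.+ j) → us ++ map proj₁ ps ↭ allFin n →
             l G σ ≤ (j ℕ.* List.length us ℕ.+ ⌊ List.length us ²/4⌋) ℕ.+ cost ps
  l≤extend j us ps odd all with qs , covers , bound ← extend j us ps odd =
    ≤-trans (l≤cost qs (↭-trans (↭-reflexive covers) all)) bound

  edges≤length : ∀ u vs → edges u vs ≤ List.length vs
  edges≤length u = sum-map-≤length (λ v → 𝟙≤1 (adj G u v))

  edges<length : ∀ u {vs} → Any (λ v → adj G u v ≡ false) vs → edges u vs < List.length vs
  edges<length u {v ∷ vs} (here eq) =
    s≤s (subst (λ b → 𝟙 b ℕ.+ edges u vs ≤ List.length vs) (sym eq) (edges≤length u vs))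
  edges<length u {v ∷ vs} (there ∃v) =
    subst (_≤ suc (List.length vs)) (+-suc _ _) (+-mono-≤ (𝟙≤1 (adj G u v)) (edges<length u ∃v))

  -- The path a v b has cost 0.
  l≤path : ∀ {v a b us} → adj G b a ≡ false → us ++ b ∷ a ∷ v ∷ [] ↭ allFin n →
           l G σ ≤ List.length us ℕ.+ ⌊ List.length us ²/4⌋
  l≤path {v} {a} {b} {us} b≁a all
    -- Each of `a` and `b` has at most one edge to the vertices before it, `b` because it is not
    -- adjacent to `a`, and ⌊1/2⌋ = 0. The three vertices of the path then give j = 1 in `l≤extend`.
    with s , ≤a ← add-vertex a ((v , Sign.+) ∷ []) 1 (edges≤length a (v ∷ []))
    with t , ≤b ← add-vertex b ((a , s) ∷ (v , Sign.+) ∷ []) 1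
           (ℕ.≤-pred (edges<length b {a ∷ v ∷ []} (here b≁a)))
    = begin
    l G σ
      ≤⟨ l≤extend 1 us ((b , t) ∷ (a , s) ∷ (v , Sign.+) ∷ []) refl all ⟩
    (1 ℕ.* m ℕ.+ ⌊ m ²/4⌋) ℕ.+ cost ((b , t) ∷ (a , s) ∷ (v , Sign.+) ∷ [])
      ≤⟨ +-monoʳ-≤ (1 ℕ.* m ℕ.+ ⌊ m ²/4⌋) (≤-trans ≤b ≤a) ⟩
    (1 ℕ.* m ℕ.+ ⌊ m ²/4⌋) ℕ.+ 0
      ≡⟨ trans (+-identityʳ _) (cong (ℕ._+ ⌊ m ²/4⌋) (*-identityˡ m)) ⟩
    m ℕ.+ ⌊ m ²/4⌋ ∎
    where
    open ≤-Reasoning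
    m = List.length us

  -- Positive triangles

  record PositiveTriangle (p q r : Fin n) : Set where
    field
      pq       : G [ p ~ q ]
      pr       : G [ p ~ r ]
      qr       : G [ q ~ r ]
      positive : sign σ qr ≡ sign σ pq · sign σ pr

  swap-positive : ∀ {p q r} → PositiveTriangle p q r → PositiveTriangle p r q
  swap-positive {p} {q} {r} t = record
    { pq       = pr
    ; pr       = pq
    ; qr       = rq
    ; positive = trans (sign-sym σ rq qr) (trans positive (Sign.*-comm (sign σ pq) (sign σ pr)))
    }
    where
    open PositiveTriangle t
    rq = subst T (adj-sym G q r) qr

  -- With value `+` at `p`, the values at `q` and `r` are forced by their edges to `p`; positivity
  -- says that the third edge agrees as well.
  cost-positiveTriangle : ∀ {p q r} → PositiveTriangle p q r →
                          ∃[ ps ] map proj₁ ps ≡ p ∷ q ∷ r ∷ [] × cost ps ≡ 0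
  cost-positiveTriangle {p} {q} {r} t =
    (p , Sign.+) ∷ (q , sign σ pq) ∷ (r , sign σ pr) ∷ [] , refl , cong₂ ℕ._+_
      (cong₂ (λ c d → c ℕ.+ (d ℕ.+ 0)) (conflict-agree (adj G p q) pq) (conflict-agree (adj G p r) pr))
      (cong (λ c → (c ℕ.+ 0) ℕ.+ 0)
        (subst (λ s → 𝟙 (conflict (adj G q r) (sign σ) s) ≡ 0) positive (conflict-agree (adj G q r) qr)))
    where open PositiveTriangle t

  -- A positive triangle has cost 0, and each of y, z then sees at most three vertices.
  l<positiveTriangle :
    ∀ {p q r y z us} → PositiveTriangle p q r →
    Any (λ v → adj G z v ≡ false) (y ∷ p ∷ q ∷ r ∷ []) →
    us ++ z ∷ y ∷ p ∷ q ∷ r ∷ [] ↭ allFin n →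
    l G σ < 2 ℕ.+ List.length us ℕ.+ ⌊ 2 ℕ.+ List.length us ²/4⌋
  l<positiveTriangle {p} {q} {r} {y} {z} {us} t z≁ all
    with triangle@(_ ∷ _ ∷ _ ∷ []) , refl , free ← cost-positiveTriangle t
    with s , ≤y ← add-vertex y triangle 3 (edges≤length y (p ∷ q ∷ r ∷ []))
    with r′ , ≤z ← add-vertex z ((y , s) ∷ triangle) 3 (ℕ.≤-pred (edges<length z z≁))
    = begin-strict
    l G σ
      ≤⟨ l≤extend 2 us ((z , r′) ∷ (y , s) ∷ triangle) refl all ⟩
    (2 ℕ.* m ℕ.+ ⌊ m ²/4⌋) ℕ.+ cost ((z , r′) ∷ (y , s) ∷ triangle)
      ≤⟨ +-monoʳ-≤ (2 ℕ.* m ℕ.+ ⌊ m ²/4⌋) (≤-trans ≤z (s≤s ≤y)) ⟩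
    (2 ℕ.* m ℕ.+ ⌊ m ²/4⌋) ℕ.+ (1 ℕ.+ (1 ℕ.+ cost triangle))
      ≡⟨ cong (λ c → (2 ℕ.* m ℕ.+ ⌊ m ²/4⌋) ℕ.+ (1 ℕ.+ (1 ℕ.+ c))) free ⟩
    (2 ℕ.* m ℕ.+ ⌊ m ²/4⌋) ℕ.+ 2
      -- With k = m + 2, the bound k + ⌊k²/4⌋ is 2m + 3 + ⌊m²/4⌋, one more than what the triangle
      -- gives.
      <⟨ n<1+n _ ⟩
    suc ((2 ℕ.* m ℕ.+ ⌊ m ²/4⌋) ℕ.+ 2)
      ≡⟨ regroup m ⌊ m ²/4⌋ ⟩
    2 ℕ.+ m ℕ.+ (⌊ m ²/4⌋ ℕ.+ suc m)
      ≡⟨ cong (2 ℕ.+ m ℕ.+_) (quarterSquare-+2 m) ⟨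
    2 ℕ.+ m ℕ.+ ⌊ 2 ℕ.+ m ²/4⌋ ∎
    where
    open ≤-Reasoning
    m = List.length us
    regroup : ∀ m c → suc ((2 ℕ.* m ℕ.+ c) ℕ.+ 2) ≡ 2 ℕ.+ m ℕ.+ (c ℕ.+ suc m)
    regroup = solve-∀

  -- Switching at the vertices joined to `p` by a positive edge makes all edges at `p` negative. Any
  -- other edge closes a triangle with `p`, whose sign switching preserves; this triangle is
  -- negative, so the edge has become negative too.
  allTrianglesNegative⇒equivalent :
    ∀ p → (∀ v → p ≡ v ⊎ G [ p ~ v ]) →
    (∀ u v → ¬ PositiveTriangle p u v) →
    SwitchingEquivalent σ allNegative
  allTrianglesNegative⇒equivalent p dominating negativeTriangle = Vec.tabulate positive , λ {u} {v} h →
    trans (cong₂ (λ b c → if b xor c then opposite (sign σ h) else sign σ h)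
                 (lookup∘tabulate positive u) (lookup∘tabulate positive v))
          (switched h (dominating u) (dominating v))
    where
    positive : Fin n → Bool
    positive v = conflict (adj G p v) (sign σ) Sign.-

    positive-p : positive p ≡ false
    positive-p = no-edge⇒no-conflict (sign σ) Sign.- (adj-irrefl G p)

    toggle : Sign → Bool → Bool → Sign
    toggle t b c = if b xor c then opposite t else t

    away : ∀ r s t → t ≢ r · s → toggle t (negative (r · Sign.-)) (negative (s · Sign.-)) ≡ Sign.-
    away Sign.+ Sign.+ Sign.+ ≢ = contradiction refl ≢
    away Sign.+ Sign.+ Sign.- ≢ = refl
    away Sign.+ Sign.- Sign.+ ≢ = refl
    away Sign.+ Sign.- Sign.- ≢ = contradiction refl ≢
    away Sign.- Sign.+ Sign.+ ≢ = refl
    away Sign.- Sign.+ Sign.- ≢ = contradiction refl ≢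
    away Sign.- Sign.- Sign.+ ≢ = contradiction refl ≢
    away Sign.- Sign.- Sign.- ≢ = refl

    atˡ : ∀ t → toggle t false (negative (t · Sign.-)) ≡ Sign.-
    atˡ Sign.+ = refl
    atˡ Sign.- = refl

    atʳ : ∀ t → toggle t (negative (t · Sign.-)) false ≡ Sign.-
    atʳ Sign.+ = refl
    atʳ Sign.- = refl

    switched : ∀ {u v} (h : G [ u ~ v ]) → p ≡ u ⊎ G [ p ~ u ] → p ≡ v ⊎ G [ p ~ v ] →
               toggle (sign σ h) (positive u) (positive v) ≡ Sign.-
    switched {v = v} h (inj₁ refl) _ =
      trans (cong₂ (toggle (sign σ h)) positive-p (conflict-edge (adj G p v) h)) (atˡ (sign σ h))
    switched {u} h (inj₂ e) (inj₁ refl) =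
      trans (cong₂ (toggle (sign σ h))
              (trans (conflict-edge (adj G p u) e) (cong (λ t → negative (t · Sign.-)) (sign-sym σ e h)))
              positive-p)
            (atʳ (sign σ h))
    switched {u} {v} h (inj₂ e) (inj₂ f) =
      trans (cong₂ (toggle (sign σ h)) (conflict-edge (adj G p u) e) (conflict-edge (adj G p v) f))
            (away (sign σ e) (sign σ f) (sign σ h) λ eq →
              negativeTriangle u v record { pq = e ; pr = f ; qr = h ; positive = eq })

-- Lower bound for the all-negative signature

~⇒≢ : ∀ {n} (G : Graph n) {u v} → G [ u ~ v ] → u ≢ v
~⇒≢ G {u} e refl = subst T (adj-irrefl G u) e

-- A triangle would be a cycle whose sign is a product of three negative signs.
balanced⇒triangle-free : ∀ {n} (G : Graph n) → Balanced G allNegative →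
                         ∀ u v w → G [ u ~ v ] → G [ u ~ w ] → G [ v ~ w ] → ⊥
balanced⇒triangle-free G balanced u v w uv uw vw
  with () ← balanced record
    { path     = uv ∷ vw ∷ []
    ; isPath   = (~⇒≢ G uv ∷ ~⇒≢ G uw ∷ []) ∷ (~⇒≢ G vw ∷ []) ∷ [] ∷ []
    ; 2≤length = s≤s (s≤s z≤n)
    ; closing  = subst T (adj-sym G u w) uw
    }

-- What is left after a minimum deletion is balanced, hence triangle-free, and Mantel's theorem
-- bounds it.
size≤l+mantel : ∀ {n} (G : Graph n) → size G ≤ ⌊ n ²/4⌋ ℕ.+ l G allNegative
size≤l+mantel {n} G with (D , D⊆G , size≡l , balanced) , _ ← l-isMinimum G allNegative = begin
  size G
    ≡⟨ size-∖ G D D⊆G ⟩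
  size (G ∖ D) ℕ.+ size D
    ≡⟨ cong₂ ℕ._+_ (size≡pairSum (G ∖ D)) size≡l ⟩
  pairSum (λ u v → 𝟙 (adj (G ∖ D) u v)) (allFin n) ℕ.+ l G allNegative
    ≤⟨ +-monoˡ-≤ (l G allNegative)
         (mantel (adj (G ∖ D)) (adj-sym (G ∖ D)) (balanced⇒triangle-free (G ∖ D) balanced) (allFin n)) ⟩
  ⌊ List.length (allFin n) ²/4⌋ ℕ.+ l G allNegative
    ≡⟨ cong (λ m → ⌊ m ²/4⌋ ℕ.+ l G allNegative) (length-tabulate {n = n} id) ⟩
  ⌊ n ²/4⌋ ℕ.+ l G allNegative ∎
  where open ≤-Reasoning

-- Complete split graphs

allFin-suc : ∀ n → allFin (suc n) ≡ zero ∷ map suc (allFin n)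
allFin-suc n = cong (zero ∷_) (sym (map-tabulate id suc))

allFin-+ : ∀ m n → allFin (m ℕ.+ n) ≡ map (_↑ˡ n) (allFin m) ++ map (m ↑ʳ_) (allFin n)
allFin-+ zero    n = sym (map-id (allFin n))
allFin-+ (suc m) n = begin
  allFin (suc (m ℕ.+ n))
    ≡⟨ allFin-suc (m ℕ.+ n) ⟩
  zero ∷ map suc (allFin (m ℕ.+ n))
    ≡⟨ cong (λ vs → zero ∷ map suc vs) (allFin-+ m n) ⟩
  zero ∷ map suc (map (_↑ˡ n) (allFin m) ++ map (m ↑ʳ_) (allFin n))
    ≡⟨ cong (zero ∷_) (map-++ suc (map (_↑ˡ n) (allFin m)) _) ⟩
  zero ∷ map suc (map (_↑ˡ n) (allFin m)) ++ map suc (map (m ↑ʳ_) (allFin n))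
    ≡⟨ cong₂ (λ us vs → zero ∷ us ++ vs)
         (trans (sym (map-∘ (allFin m))) (map-∘ (allFin m))) (sym (map-∘ (allFin n))) ⟩
  zero ∷ map (_↑ˡ n) (map suc (allFin m)) ++ map (suc m ↑ʳ_) (allFin n)
    ≡⟨ cong (λ us → map (_↑ˡ n) us ++ map (suc m ↑ʳ_) (allFin n)) (allFin-suc m) ⟨
  map (_↑ˡ n) (allFin (suc m)) ++ map (suc m ↑ʳ_) (allFin n) ∎
  where open ≡-Reasoning

-- Supplies a further clique vertex when a triangle already occupies `centre` and one other.
allFin-↭∷∷ : ∀ {n} → 2 ≤ n → ∀ (i : Fin n) → ∃[ j ] ∃[ us ] allFin n ↭ i ∷ j ∷ us
allFin-↭∷∷ {n} 2≤n i with ∈⇒↭∷ (∈-allFin i)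
... | j ∷ us , p = j , us , p
... | []     , p with s≤s () ← subst (2 ≤_) (trans (sym (length-tabulate {n = n} id)) (↭-length p)) 2≤n

module _ (k : ℕ) where

  private
    n : ℕ
    n = suc k

    S : Graph (n ℕ.+ 2)
    S = completeSplit n 2

    -- `κ` embeds the clique and `ι` the independent pair.
    κ : Fin n → Fin (n ℕ.+ 2)
    κ = _↑ˡ 2

    ι : Fin 2 → Fin (n ℕ.+ 2)
    ι = n ↑ʳ_

    centre : Fin (n ℕ.+ 2)
    centre = κ zero

  adj-κκ : ∀ i j → adj S (κ i) (κ j) ≡ not (does (i ≟ j))
  adj-κκ i j rewrite splitAt-↑ˡ n i 2 | splitAt-↑ˡ n j 2 = refl

  adj-ικ : ∀ i j → adj S (ι i) (κ j) ≡ true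
  adj-ικ i j rewrite splitAt-↑ʳ n 2 i | splitAt-↑ˡ n j 2 = refl

  adj-ιι : ∀ i j → adj S (ι i) (ι j) ≡ false
  adj-ιι i j rewrite splitAt-↑ʳ n 2 i | splitAt-↑ʳ n 2 j = refl

  clique-edge : ∀ i j → i ≢ j → S [ κ i ~ κ j ]
  clique-edge i j i≢j rewrite adj-κκ i j with i ≟ j
  ... | yes i≡j = i≢j i≡j
  ... | no  _   = _

  clique-or-independent : ∀ v → (∃[ i ] κ i ≡ v) ⊎ (∃[ j ] ι j ≡ v)
  clique-or-independent v with splitAt n v in eq
  ... | inj₁ i = inj₁ (i , splitAt⁻¹-↑ˡ eq)
  ... | inj₂ j = inj₂ (j , splitAt⁻¹-↑ʳ eq)

  -- On `Fin 2`, `Fin.opposite` exchanges the two elements, so either independent vertex can be put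
  -- in front.
  vertices↭ : ∀ j → allFin (n ℕ.+ 2) ↭ ι j ∷ ι (Fin.opposite j) ∷ map κ (allFin n)
  vertices↭ j = ↭-trans (↭-reflexive (allFin-+ n 2))
    (↭-trans (++-comm (map κ (allFin n)) (map ι (allFin 2))) (order j))
    where
    order : ∀ j → map ι (allFin 2) ++ map κ (allFin n) ↭ ι j ∷ ι (Fin.opposite j) ∷ map κ (allFin n)
    order zero       = ↭-refl
    order (suc zero) = Perm.swap _ _ ↭-refl

  size-completeSplit : size S ≡ (n ℕ.+ n) ℕ.+ (⌊ n ²/4⌋ ℕ.+ ⌊ k ²/4⌋)
  size-completeSplit = begin
    size S
      ≡⟨ size≡pairSum S ⟩
    pairSum e (allFin (n ℕ.+ 2))
      ≡⟨ pairSum-↭ (λ u v → cong 𝟙 (adj-sym S u v)) (vertices↭ zero) ⟩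
    (e (ι zero) (ι (suc zero)) ℕ.+ star zero) ℕ.+ (star (suc zero) ℕ.+ pairSum e (map κ (allFin n)))
      ≡⟨ cong₂ ℕ._+_ (cong₂ ℕ._+_ (cong 𝟙 (adj-ιι zero (suc zero))) (star≡n zero))
                     (cong₂ ℕ._+_ (star≡n (suc zero)) clique) ⟩
    n ℕ.+ (n ℕ.+ (⌊ n ²/4⌋ ℕ.+ ⌊ k ²/4⌋))
      ≡⟨ +-assoc n n _ ⟨
    (n ℕ.+ n) ℕ.+ (⌊ n ²/4⌋ ℕ.+ ⌊ k ²/4⌋) ∎
    where
    open ≡-Reasoning
    e : Fin (n ℕ.+ 2) → Fin (n ℕ.+ 2) → ℕ
    e u v = 𝟙 (adj S u v)

    star : Fin 2 → ℕ
    star j = sum (map (e (ι j)) (map κ (allFin n)))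

    length≡n : List.length (map κ (allFin n)) ≡ n
    length≡n = trans (length-map κ (allFin n)) (length-tabulate id)

    star≡n : ∀ j → star j ≡ n
    star≡n j = trans
      (sum-map-≡length (All.map⁺ (All.universal (λ i → cong 𝟙 (adj-ικ j i)) (allFin n))))
      length≡n

    clique : pairSum e (map κ (allFin n)) ≡ ⌊ n ²/4⌋ ℕ.+ ⌊ k ²/4⌋
    clique = trans
      (pairSum-complete (AllPairs.map⁺ (AllPairs.map
        (λ {i} {j} i≢j → cong 𝟙 (Equivalence.to T-≡ (clique-edge i j i≢j))) (allFin⁺ n))))
      (cong (λ m → ⌊ m ²/4⌋ ℕ.+ ⌊ ℕ.pred m ²/4⌋) length≡n)

  -- The path of cost 0 runs through `centre`, which leaves `k` clique vertices to add.
  l-completeSplit≤ : ∀ σ → l S σ ≤ k ℕ.+ ⌊ k ²/4⌋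
  l-completeSplit≤ σ = subst (λ m → l S σ ≤ m ℕ.+ ⌊ m ²/4⌋)
    (trans (length-map κ (tabulate suc)) (length-tabulate {n = k} Fin.suc))
    (l≤path S σ {us = map κ (tabulate suc)} (adj-ιι zero (suc zero))
      (↭-trans (++-comm (map κ (tabulate suc)) _) (↭-sym (vertices↭ zero))))

  -- The number of edges is exactly Mantel's bound for n + 2 vertices plus the claimed value. Adding
  -- that bound to both sides avoids truncated subtraction.
  ≤l-allNegative : k ℕ.+ ⌊ k ²/4⌋ ≤ l S allNegative
  ≤l-allNegative = +-cancelˡ-≤ ⌊ n ℕ.+ 2 ²/4⌋ _ _ (begin
    ⌊ n ℕ.+ 2 ²/4⌋ ℕ.+ (k ℕ.+ ⌊ k ²/4⌋)
      ≡⟨ cong (λ m → ⌊ m ²/4⌋ ℕ.+ (k ℕ.+ ⌊ k ²/4⌋)) (+-comm (suc k) 2) ⟩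
    ⌊ 2 ℕ.+ suc k ²/4⌋ ℕ.+ (k ℕ.+ ⌊ k ²/4⌋)
      ≡⟨ cong (ℕ._+ (k ℕ.+ ⌊ k ²/4⌋)) (quarterSquare-+2 (suc k)) ⟩
    (⌊ suc k ²/4⌋ ℕ.+ (2 ℕ.+ k)) ℕ.+ (k ℕ.+ ⌊ k ²/4⌋)
      ≡⟨ regroup k ⌊ suc k ²/4⌋ ⌊ k ²/4⌋ ⟩
    (suc k ℕ.+ suc k) ℕ.+ (⌊ suc k ²/4⌋ ℕ.+ ⌊ k ²/4⌋)
      ≡⟨ size-completeSplit ⟨
    size S
      ≤⟨ size≤l+mantel S ⟩
    ⌊ n ℕ.+ 2 ²/4⌋ ℕ.+ l S allNegative ∎)
    where
    open ≤-Reasoning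
    regroup : ∀ k p q → (p ℕ.+ (2 ℕ.+ k)) ℕ.+ (k ℕ.+ q) ≡ (suc k ℕ.+ suc k) ℕ.+ (p ℕ.+ q)
    regroup = solve-∀

  l-allNegative : l S allNegative ≡ k ℕ.+ ⌊ k ²/4⌋
  l-allNegative = ≤-antisym (l-completeSplit≤ allNegative) ≤l-allNegative

  l-allNegative≡lmax : l S allNegative ≡ lmax S
  l-allNegative≡lmax with (σ , l≡lmax) , maximal ← lmax-isMaximum S = ≤-antisym
    (maximal _ (allNegative , refl))
    (subst (_≤ l S allNegative) l≡lmax (≤-trans (l-completeSplit≤ σ) ≤l-allNegative))

  -- Signatures with a positive triangle at the centre

  module _ (σ : Signature S) where

    -- Five of the k + 3 vertices are listed, so `us` has length k - 2, and the quantity 2 +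
    -- `List.length us` of the general bound is `k`.
    l<positive : ∀ {p q r y z us} → PositiveTriangle S σ p q r →
                 Any (λ v → adj S z v ≡ false) (y ∷ p ∷ q ∷ r ∷ []) →
                 allFin (n ℕ.+ 2) ↭ z ∷ y ∷ p ∷ q ∷ r ∷ us →
                 l S σ < k ℕ.+ ⌊ k ²/4⌋
    l<positive {us = us} t z≁ all = subst (λ m → l S σ < m ℕ.+ ⌊ m ²/4⌋)
      (ℕ.suc-injective (ℕ.suc-injective (ℕ.suc-injective
        (trans (sym (↭-length all)) (trans (length-tabulate {n = n ℕ.+ 2} id) (cong suc (+-comm k 2)))))))
      (l<positiveTriangle S σ {us = us} t z≁ (↭-trans (++-comm us _) (↭-sym all)))

    -- The two independent vertices complete the triangle to five vertices, and they are not
    -- adjacent to each other.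
    l<positive-clique : ∀ i j → i ≢ j → PositiveTriangle S σ centre (κ (suc i)) (κ (suc j)) →
                        l S σ < k ℕ.+ ⌊ k ²/4⌋
    l<positive-clique i j i≢j t
      with ys , ↭i∷ys ← ∈⇒↭∷ (∈-allFin i)
      with ∈-resp-↭ ↭i∷ys (∈-allFin j)
    ... | here j≡i = contradiction (sym j≡i) i≢j
    ... | there j∈ys
      with zs , ↭j∷zs ← ∈⇒↭∷ j∈ys
      = l<positive {y = ι (suc zero)} {ι zero} t (here (adj-ιι zero (suc zero)))
          (↭-trans (vertices↭ zero) (prep _ (prep _ (map⁺ κ
            (↭-trans (↭-reflexive (allFin-suc k)) (prep zero (map⁺ suc (↭-trans ↭i∷ys (prep i ↭j∷zs)))))))))

    -- The triangle is completed by the other independent vertex, which is not adjacent to `ι j`,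
    -- and by a third clique vertex, which exists because 2 ≤ k.
    l<positive-mixed : 2 ≤ k → ∀ i j → PositiveTriangle S σ centre (κ (suc i)) (ι j) →
                       l S σ < k ℕ.+ ⌊ k ²/4⌋
    l<positive-mixed 2≤k i j t
      with c , zs , ↭i∷c∷zs ← allFin-↭∷∷ 2≤k i
      = l<positive {y = κ (suc c)} {ι (Fin.opposite j)} t
          (there (there (there (here (adj-ιι (Fin.opposite j) j)))))
          (↭-trans (vertices↭ j) (↭-trans (Perm.swap _ _ ↭-refl) (prep _ (↭-trans
            (prep _ (map⁺ κ reordered))
            (↭-sym (shift (ι j) (κ (suc c) ∷ κ zero ∷ κ (suc i) ∷ []) (map κ (map suc zs))))))))
      where
      reordered : allFin (suc k) ↭ suc c ∷ zero ∷ suc i ∷ map suc zs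
      reordered = ↭-trans (↭-reflexive (allFin-suc k))
        (↭-trans (prep zero (map⁺ suc ↭i∷c∷zs)) (shift (suc c) (zero ∷ suc i ∷ []) (map suc zs)))

    positiveTriangle⇒l< : 2 ≤ k → ∀ u v → PositiveTriangle S σ centre u v → l S σ < k ℕ.+ ⌊ k ²/4⌋
    positiveTriangle⇒l< 2≤k u v t with clique-or-independent u | clique-or-independent v
    ... | inj₁ (zero  , refl) | _                   = ⊥-elim (~⇒≢ S {u = centre} (PositiveTriangle.pq t) refl)
    ... | _                   | inj₁ (zero  , refl) = ⊥-elim (~⇒≢ S {u = centre} (PositiveTriangle.pr t) refl)
    ... | inj₁ (suc i , refl) | inj₁ (suc j , refl) =
      l<positive-clique i j (λ i≡j → ~⇒≢ S {u = u} {v} (PositiveTriangle.qr t) (cong (κ ∘ suc) i≡j)) t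
    ... | inj₁ (suc i , refl) | inj₂ (j , refl)     = l<positive-mixed 2≤k i j t
    ... | inj₂ (i , refl)     | inj₁ (suc j , refl) = l<positive-mixed 2≤k j i (swap-positive S σ t)
    ... | inj₂ (i , refl)     | inj₂ (j , refl)     = ⊥-elim (subst T (adj-ιι i j) (PositiveTriangle.qr t))

  maximisesUniquely : 2 ≤ k → AllNegativeMaximisesUniquely S
  maximisesUniquely 2≤k = l-allNegative≡lmax , λ σ l≡lmax →
    allTrianglesNegative⇒equivalent S σ centre dominating λ u v t →
      <-irrefl (trans l≡lmax (trans (sym l-allNegative≡lmax) l-allNegative))
               (positiveTriangle⇒l< σ 2≤k u v t)
    where
    dominating : ∀ v → centre ≡ v ⊎ S [ centre ~ v ]
    dominating v with clique-or-independent v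
    ... | inj₁ (zero  , refl) = inj₁ refl
    ... | inj₁ (suc i , refl) = inj₂ (clique-edge zero (suc i) λ ())
    ... | inj₂ (j , refl)     = inj₂ (subst T (trans (sym (adj-ικ j zero)) (adj-sym S (ι j) centre)) _)

-- Addition of unnormalised rationals gives denominator 4 · 1 and leaves the numerator k² · 1 + k ·
-- 4, so the floor is a plain integer division by 4.
floor-formula : ∀ k → floor ((+ k) ^ 2 / 4 + + k / 1) ≡ + (k ℕ.+ ⌊ k ²/4⌋)
floor-formula k = begin
  ((+ k) ^ 2 ℤ.* + 1 ℤ.+ + k ℤ.* + 4) ℤ./ + 4
    ≡⟨ cong (ℤ._/ + 4) numerator ⟩
  + (k ℕ.* k ℕ.+ k ℕ.* 4) ℤ./ + 4
    ≡⟨ div-pos-is-/ℕ (+ (k ℕ.* k ℕ.+ k ℕ.* 4)) 4 ⟩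
  + ((k ℕ.* k ℕ.+ k ℕ.* 4) ℕ./ 4)
    ≡⟨ cong +_ (+-distrib-/-∣ʳ (k ℕ.* k) (divides-refl k)) ⟩
  + (⌊ k ²/4⌋ ℕ.+ k ℕ.* 4 ℕ./ 4)
    ≡⟨ cong (λ m → + (⌊ k ²/4⌋ ℕ.+ m)) (m*n/n≡m k 4) ⟩
  + (⌊ k ²/4⌋ ℕ.+ k)
    ≡⟨ cong +_ (+-comm ⌊ k ²/4⌋ k) ⟩
  + (k ℕ.+ ⌊ k ²/4⌋) ∎
  where
  open ≡-Reasoning
  numerator : (+ k) ^ 2 ℤ.* + 1 ℤ.+ + k ℤ.* + 4 ≡ + (k ℕ.* k ℕ.+ k ℕ.* 4)
  numerator = cong₂ ℤ._+_
    (trans (ℤ.*-identityʳ _) (trans (cong (+ k ℤ.*_) (ℤ.*-identityʳ (+ k))) (sym (ℤ.pos-* k k))))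
    (sym (ℤ.pos-* k 4))

theorem31 : ∀ (n : ℕ) → 3 ≤ n →
    AllNegativeMaximisesUniquely (completeSplit n 2) ×
    lmax (completeSplit n 2) ≡ l (completeSplit n 2) allNegative ×
    + l (completeSplit n 2) allNegative ≡ floor ((+ n - 1ℤ) ^ 2 / 4 + (+ n - 1ℤ) / 1)
-- For `n` of the form `suc k`, the integer `+ n - 1ℤ` computes to `+ k`.
theorem31 (suc k) (s≤s 2≤k) =
    maximisesUniquely k 2≤k
  , sym (l-allNegative≡lmax k)
  , trans (cong +_ (l-allNegative k)) (sym (floor-formula k))
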